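{- Let $p$ be a prime and $d\geq 3$ an integer. Then every sequence of length $(6p-4)p^{d-3}+1$ in $\mathbb{Z}_p^d$ contains a zero-sum subsequence of length at most $\frac{3p-1}{2}$. If $d\geq 4$, then every sequence of length $(6p-4)p^{d-4}+1$ in $\mathbb{Z}_p^d$ contains a zero-sum subsequence of length at most $2p$.
   Context: $\mathbb{Z}_p=\mathbb{Z}/p\mathbb{Z}$. A sequence is a finite sequence of elements (repetitions allowed); a zero-sum subsequence of length $\ell$ is a choice of $\ell\geq 1$ distinct indices whose corresponding terms sum to $0$. -}

module Defs where

open import Data.Nat using (ℕ; zero; suc; _+_; _*_; _∸_; _^_; _≤_; _%_; NonZero)
open import Data.Nat.Primality using (Prime)
open import Data.Fin using (Fin; toℕ) renaming (zero to fzero; suc to fsuc)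
open import Data.Fin.Subset using (Subset; _∈_; ∣_∣; Nonempty)
open import Data.Vec using (lookup)
open import Data.Bool using (Bool; true; false; if_then_else_)
open import Data.Product using (Σ; _×_)
open import Relation.Binary.PropositionalEquality using (_≡_)

ZpVec : ℕ → ℕ → Set
ZpVec p d = Fin d → Fin p

Seq : ℕ → ℕ → ℕ → Set
Seq p d n = Fin n → ZpVec p d

Σℕ : (n : ℕ) → (Fin n → ℕ) → ℕ
Σℕ zero    f = 0
Σℕ (suc n) f = f fzero + Σℕ n (λ i → f (fsuc i))

selSum : ∀ {p d n} → Seq p d n → Subset n → Fin d → ℕ
selSum {n = n} s S j = Σℕ n (λ i → if lookup S i then toℕ (s i j) else 0)

IsZeroSum : ∀ {p d n} .{{_ : NonZero p}} → Seq p d n → Subset n → Set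
IsZeroSum {p} {d} s S = (j : Fin d) → selSum s S j % p ≡ 0

HasShortZeroSum : ∀ {p d n} .{{_ : NonZero p}} → Seq p d n → (ℕ → Set) → Set
HasShortZeroSum {n = n} s Bound =
  Σ (Subset n) λ S → Nonempty S × IsZeroSum s S × Bound ∣ S ∣

{-# OPTIONS --safe #-}
module Submission where

-- Let A index a sequence without short zero-sum subsequence. The alternating sum over x ⊆ A of a polynomial of degree
-- less than |A| in the indicator variables of x vanishes, so a polynomial that is divisible by p at all nonempty x ⊆ A
-- is divisible by p at the empty set. The polynomial used is the product of indicators mod p of the vanishing of each
-- coordinate sum and of |x|, times factors C(|x|, p) - C(m p, p) which remove the length m p. In dimension 3 the
-- lengths 2p and 4p are removed in this way; p is short; a zero-sum sequence of length 3p or 5p splits, again by the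
-- polynomial method applied to all but one of its terms. In dimension 4 only 3p has to be removed, which needs p ≠ 3.
--
-- The dimension is raised by a line ⟨e⟩ that contains no term of the sequence: some hyperplane avoiding e then contains
-- at least a proportion 1/p of the terms. Such a line exists by counting, except in the first part for p = 3 (and p = 2,
-- where two terms coincide); there, if the four lines of a plane are all hit, three of the terms hitting them sum to 0.
--
-- Fifteen terms in F₃⁴: if 14 of them are distinct, three of their 2 · 91 signed pair sums agree, which produces a
-- zero-sum of length at most 6. Otherwise two values a, b are doubled, and the other 11 terms are studied modulo ⟨a, b⟩.

open import Defs
open import Data.Bool using (Bool; true; false; _∧_; if_then_else_)
open import Data.Empty using (⊥-elim) renaming (⊥ to Empty)
open import Data.Fin as Fin using (Fin; zero; suc; toℕ; fromℕ<; punchIn; punchOut; remQuot)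
open import Data.Fin.Patterns using (0F; 1F; 2F; 3F)
import Data.Fin.Properties as Fin
open import Data.Fin.Subset using (Subset; inside; outside; ∣_∣; _∈_; _∉_; _⊆_; _─_; _∪_; ⁅_⁆; ⊥; ⊤)
open import Data.Fin.Subset.Properties
  using (drop-∷-⊆; out⊆; in⊆in; ⊥⊆; ∉⊥; ∪-identityˡ; x∈p∪q⁻; p⊆p∪q; q⊆p∪q; x∈⁅x⁆; x∈⁅y⁆⇒x≡y; ∣⁅x⁆∣≡1; ∣⊥∣≡0; ∣⊤∣≡n;
         p⊆q⇒∣p∣≤∣q∣; p─q⊆p; x∈p∧x∉q⇒x∈p─q; _∈?_; nonempty?; anySubset?)
open import Data.Integer as ℤ using (ℤ; +_; 0ℤ)
import Data.Integer.DivMod as ℤ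
open import Data.Integer.Divisibility.Signed
  using (_∣_; divides; _∣?_; ∣ᵤ⇒∣; ∣⇒∣ᵤ; ∣m∣n⇒∣m+n; ∣m∣n⇒∣m-n; ∣m+n∣m⇒∣n; ∣n⇒∣m*n; ∣m⇒∣m*n; ∣m⇒∣-m)
import Data.Integer.Properties as ℤ
open import Data.Integer.Tactic.RingSolver using (solve-∀)
open import Data.List using (List; []; _∷_; _++_; length)
open import Data.List.Properties using (length-++)
open import Data.List.Relation.Unary.All as All using (All; []; _∷_)
import Data.List.Relation.Unary.All.Properties as All
open import Data.List.Relation.Unary.AllPairs using ([]; _∷_)
import Data.List.Relation.Unary.AllPairs.Properties as AllPairs
open import Data.List.Relation.Unary.Unique.Propositional using (Unique)
open import Data.Nat using (ℕ; zero; suc; _+_; _*_; _∸_; _^_; _≤_; _<_; z≤n; s≤s; _≤?_; _<?_; _≟_; _/_; _%_; nonTrivial⇒n>1)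
open import Data.Nat.Combinatorics using (_C_; nCk+nC[k+1]≡[n+1]C[k+1]; nC1≡n)
open import Data.Nat.Coprimality using (prime⇒coprime; coprime-Bézout)
import Data.Nat.Divisibility as ℕ
open import Data.Nat.DivMod using (m/n*n≤m; m*n/n≡m; /-monoˡ-≤)
open import Data.Nat.GCD using (module Bézout)
open import Data.Nat.Primality using (Prime; prime?; euclidsLemma; prime⇒nonZero; prime⇒nonTrivial; prime⇒irreducible; ¬prime[0]; ¬prime[1])
open import Data.Nat.Properties hiding (_≟_; _≤?_; _<?_)
open import Data.Nat.Tactic.RingSolver using () renaming (solve-∀ to ℕ-solve-∀)
open import Data.Product using (∃; _×_; _,_; proj₁; proj₂)
open import Data.Sum using (_⊎_; inj₁; inj₂; [_,_]′)
open import Data.Unit using (tt) renaming (⊤ to Unit)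
open import Data.Vec using ([]; _∷_; here; there)
open import Function using (_∘_; id)
open import Relation.Binary.Definitions using (tri<; tri≈; tri>)
open import Relation.Binary.PropositionalEquality using (_≡_; _≢_; refl; sym; trans; cong; cong₂; subst; subst₂; module ≡-Reasoning)
open import Relation.Nullary using (¬_; Dec; yes; no; does; contradiction)
open import Relation.Nullary.Decidable using (¬?; _×-dec_; _⊎-dec_; dec-true; dec-false; toWitness; from-yes)

-- The constant 6p - 4 is a degree count. Let q = p - 1. The indicators have degree q for each
-- coordinate and q for the length, and each excluded length costs p: 3q + q + 2p = 6q + 2 in
-- dimension 3, and 4q + q + p = 6q + 1 in dimension 4. Both are below the size 6q + 3 = (6p - 4) +
-- 1. Excluding m p is possible only if C(m p, p) = m C(m p - 1, p - 1) is prime to p, that is, if p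
-- does not divide m. Hence p = 2 is separate in the first part and p = 3 in the second.
--
-- Raising the dimension may cost no more than a factor p. Averaging over all hyperplanes of F_p^d
-- is not enough: a nonzero vector lies on (p^(d-1) - 1)/(p^d - 1) of them, slightly less than 1/p.
-- Of the hyperplanes that avoid e, a vector outside ⟨e⟩ lies on exactly 1/p, and a nonzero vector
-- of ⟨e⟩ on none. This is why a line without terms is needed.
--
-- Terms have integer coordinates, and equality in F_p is divisibility of a difference by p, so that
-- linear algebra reduces to polynomial identities over ℤ. All subsequences are subsets of one index
-- set.

∑ : ∀ {n} → Subset n → (Fin n → ℤ) → ℤ
∑ []            f = 0ℤ
∑ (inside ∷ A)  f = f zero ℤ.+ ∑ A (f ∘ suc)
∑ (outside ∷ A) f = ∑ A (f ∘ suc)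

∑-⊥ : ∀ {n} (f : Fin n → ℤ) → ∑ ⊥ f ≡ 0ℤ
∑-⊥ {zero}  f = refl
∑-⊥ {suc n} f = ∑-⊥ (f ∘ suc)

∑-cong : ∀ {n} (A : Subset n) {f g : Fin n → ℤ} → (∀ i → f i ≡ g i) → ∑ A f ≡ ∑ A g
∑-cong []            f≗g = refl
∑-cong (inside ∷ A)  f≗g = cong₂ ℤ._+_ (f≗g zero) (∑-cong A (f≗g ∘ suc))
∑-cong (outside ∷ A) f≗g = ∑-cong A (f≗g ∘ suc)

∑-lincomb : ∀ {n} (A : Subset n) (a b : ℤ) (f g : Fin n → ℤ) →
  ∑ A (λ i → a ℤ.* f i ℤ.+ b ℤ.* g i) ≡ a ℤ.* ∑ A f ℤ.+ b ℤ.* ∑ A g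
∑-lincomb []            a b f g = lemma a b
  where
  lemma : ∀ a b → 0ℤ ≡ a ℤ.* 0ℤ ℤ.+ b ℤ.* 0ℤ
  lemma = solve-∀
∑-lincomb (outside ∷ A) a b f g = ∑-lincomb A a b (f ∘ suc) (g ∘ suc)
∑-lincomb (inside ∷ A)  a b f g
  rewrite ∑-lincomb A a b (f ∘ suc) (g ∘ suc) = lemma a b (f zero) (g zero) (∑ A (f ∘ suc)) (∑ A (g ∘ suc))
  where
  lemma : ∀ a b x y u v → (a ℤ.* x ℤ.+ b ℤ.* y) ℤ.+ (a ℤ.* u ℤ.+ b ℤ.* v) ≡ a ℤ.* (x ℤ.+ u) ℤ.+ b ℤ.* (y ℤ.+ v)
  lemma = solve-∀

∑-+ : ∀ {n} (A : Subset n) (f g : Fin n → ℤ) → ∑ A (λ i → f i ℤ.+ g i) ≡ ∑ A f ℤ.+ ∑ A g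
∑-+ A f g = begin
  ∑ A (λ i → f i ℤ.+ g i)                         ≡⟨ ∑-cong A (λ i → sym (lemma (f i) (g i))) ⟩
  ∑ A (λ i → + 1 ℤ.* f i ℤ.+ + 1 ℤ.* g i)         ≡⟨ ∑-lincomb A (+ 1) (+ 1) f g ⟩
  + 1 ℤ.* ∑ A f ℤ.+ + 1 ℤ.* ∑ A g                 ≡⟨ lemma (∑ A f) (∑ A g) ⟩
  ∑ A f ℤ.+ ∑ A g                                 ∎
  where
  open ≡-Reasoning
  lemma : ∀ a b → + 1 ℤ.* a ℤ.+ + 1 ℤ.* b ≡ a ℤ.+ b
  lemma = solve-∀

∑-1 : ∀ {n} (A : Subset n) → ∑ A (λ _ → + 1) ≡ + ∣ A ∣
∑-1 []            = refl
∑-1 (inside ∷ A)  = cong (ℤ._+_ (+ 1)) (∑-1 A)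
∑-1 (outside ∷ A) = ∑-1 A

∣∑ : ∀ {n p} (A : Subset n) {f : Fin n → ℤ} → (∀ {i} → i ∈ A → p ∣ f i) → p ∣ ∑ A f
∣∑ []            h = divides 0ℤ refl
∣∑ (inside ∷ A)  h = ∣m∣n⇒∣m+n (h here) (∣∑ A (h ∘ there))
∣∑ (outside ∷ A) h = ∣∑ A (h ∘ there)

∑-─ : ∀ {n} (A B : Subset n) (f : Fin n → ℤ) → B ⊆ A → ∑ A f ≡ ∑ B f ℤ.+ ∑ (A ─ B) f
∑-─ []            []            f B⊆A = refl
∑-─ (inside ∷ A)  (inside ∷ B)  f B⊆A rewrite ∑-─ A B (f ∘ suc) (drop-∷-⊆ B⊆A) =
  sym (ℤ.+-assoc (f zero) (∑ B (f ∘ suc)) (∑ (A ─ B) (f ∘ suc)))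
∑-─ (inside ∷ A)  (outside ∷ B) f B⊆A rewrite ∑-─ A B (f ∘ suc) (drop-∷-⊆ B⊆A) =
  lemma (f zero) (∑ B (f ∘ suc)) (∑ (A ─ B) (f ∘ suc))
  where
  lemma : ∀ x y z → x ℤ.+ (y ℤ.+ z) ≡ y ℤ.+ (x ℤ.+ z)
  lemma = solve-∀
∑-─ (outside ∷ A) (outside ∷ B) f B⊆A = ∑-─ A B (f ∘ suc) (drop-∷-⊆ B⊆A)
∑-─ (outside ∷ A) (inside ∷ B)  f B⊆A with B⊆A here
... | ()

∣∣-─ : ∀ {n} (A B : Subset n) → B ⊆ A → ∣ A ∣ ≡ ∣ B ∣ + ∣ A ─ B ∣
∣∣-─ []            []            B⊆A = refl
∣∣-─ (inside ∷ A)  (inside ∷ B)  B⊆A = cong suc (∣∣-─ A B (drop-∷-⊆ B⊆A))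
∣∣-─ (inside ∷ A)  (outside ∷ B) B⊆A = trans (cong suc (∣∣-─ A B (drop-∷-⊆ B⊆A))) (sym (+-suc ∣ B ∣ ∣ A ─ B ∣))
∣∣-─ (outside ∷ A) (outside ∷ B) B⊆A = ∣∣-─ A B (drop-∷-⊆ B⊆A)
∣∣-─ (outside ∷ A) (inside ∷ B)  B⊆A with B⊆A here
... | ()

∉-─ : ∀ {n} (A B : Subset n) {i} → i ∈ A ─ B → i ∉ B
∉-─ (a ∷ A) (outside ∷ B) here      ()
∉-─ (a ∷ A) (b ∷ B)       (there h) (there k) = ∉-─ A B h k

∣∣-disjoint : ∀ {n} {A B U : Subset n} → A ⊆ U → B ⊆ U → (∀ {i} → i ∈ B → i ∉ A) → ∣ A ∣ + ∣ B ∣ ≤ ∣ U ∣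
∣∣-disjoint {A = A} {B} {U} A⊆U B⊆U disj =
  ≤-trans (+-monoʳ-≤ ∣ A ∣ (p⊆q⇒∣p∣≤∣q∣ (λ i∈B → x∈p∧x∉q⇒x∈p─q (B⊆U i∈B) (disj i∈B))))
          (≤-reflexive (sym (∣∣-─ U A A⊆U)))

shrink : ∀ {n} (A : Subset n) k → k ≤ ∣ A ∣ → ∃ λ B → B ⊆ A × ∣ B ∣ ≡ k
shrink {n} A             zero    _ = ⊥ , ⊥⊆ , ∣⊥∣≡0 n
shrink (inside ∷ A)  (suc k) (s≤s h) with shrink A k h
... | B , B⊆A , eq = inside ∷ B , in⊆in B⊆A , cong suc eq
shrink (outside ∷ A) (suc k) h with shrink A (suc k) h
... | B , B⊆A , eq = outside ∷ B , out⊆ B⊆A , eq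

infixl 5 _↾_
_↾_ : ∀ {n} {P : Fin n → Set} → Subset n → (∀ i → Dec (P i)) → Subset n
[]      ↾ P? = []
(a ∷ A) ↾ P? = (a ∧ does (P? zero)) ∷ (A ↾ (P? ∘ suc))

↾⁻ : ∀ {n} {P : Fin n → Set} (A : Subset n) (P? : ∀ i → Dec (P i)) {i} → i ∈ A ↾ P? → i ∈ A × P i
↾⁻ (inside ∷ A) P? {zero} h with P? zero
... | yes p = here , p
↾⁻ (a ∷ A) P? (there h) with ↾⁻ A (P? ∘ suc) h
... | i∈A , p = there i∈A , p

↾⁺ : ∀ {n} {P : Fin n → Set} (A : Subset n) (P? : ∀ i → Dec (P i)) {i} → i ∈ A → P i → i ∈ A ↾ P?
↾⁺ (inside ∷ A) P? here p with P? zero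
... | yes _ = here
... | no ¬p = ⊥-elim (¬p p)
↾⁺ (a ∷ A) P? (there h) p = there (↾⁺ A (P? ∘ suc) h p)

↾-⊆ : ∀ {n} {P : Fin n → Set} (A : Subset n) (P? : ∀ i → Dec (P i)) → A ↾ P? ⊆ A
↾-⊆ A P? h = proj₁ (↾⁻ A P? h)

─↾⁻ : ∀ {n} {P : Fin n → Set} (A : Subset n) (P? : ∀ i → Dec (P i)) {i} → i ∈ A ─ (A ↾ P?) → i ∈ A × ¬ P i
─↾⁻ A P? h = i∈A , λ p → ∉-─ A (A ↾ P?) h (↾⁺ A P? i∈A p)
  where i∈A = p─q⊆p A (A ↾ P?) h

∣∣-↾ : ∀ {n} {P : Fin n → Set} (A : Subset n) (P? : ∀ i → Dec (P i)) → ∣ A ∣ ≡ ∣ A ↾ P? ∣ + ∣ A ─ (A ↾ P?) ∣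
∣∣-↾ A P? = ∣∣-─ A (A ↾ P?) (↾-⊆ A P?)

enumerate : ∀ {n} k (A : Subset n) → k ≤ ∣ A ∣ →
  ∃ λ (f : Fin k → Fin n) → (∀ i → f i ∈ A) × (∀ {i j} → f i ≡ f j → i ≡ j)
enumerate zero    A             _       = (λ ()) , (λ ()) , λ {}
enumerate (suc k) (inside ∷ A)  (s≤s h) with enumerate k A h
... | f , f∈A , f-inj = g , g∈A , g-inj
  where
  g : Fin (suc k) → Fin _
  g zero    = zero
  g (suc i) = suc (f i)
  g∈A : ∀ i → g i ∈ inside ∷ A
  g∈A zero    = here
  g∈A (suc i) = there (f∈A i)
  g-inj : ∀ {i j} → g i ≡ g j → i ≡ j
  g-inj {zero}  {zero}  _  = refl
  g-inj {suc i} {suc j} eq = cong suc (f-inj (Fin.suc-injective eq))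
enumerate (suc k) (outside ∷ A) h with enumerate (suc k) A h
... | f , f∈A , f-inj = suc ∘ f , there ∘ f∈A , f-inj ∘ Fin.suc-injective

-- Explicit short zero-sums, such as three or six named terms, are built as duplicate-free lists of
-- indices; `Free-list` later turns them into subsets.
fromList : ∀ {n} → List (Fin n) → Subset n
fromList []      = ⊥
fromList (i ∷ l) = ⁅ i ⁆ ∪ fromList l

∑ₗ : ∀ {n} → List (Fin n) → (Fin n → ℤ) → ℤ
∑ₗ []      f = 0ℤ
∑ₗ (i ∷ l) f = f i ℤ.+ ∑ₗ l f

fromList⁻ : ∀ {n} {P : Fin n → Set} {l : List (Fin n)} → All P l → ∀ {i} → i ∈ fromList l → P i
fromList⁻ []                  h = ⊥-elim (∉⊥ h)
fromList⁻ {l = i ∷ l} (p ∷ ps) h with x∈p∪q⁻ ⁅ i ⁆ (fromList l) h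
... | inj₁ q rewrite x∈⁅y⁆⇒x≡y i q = p
... | inj₂ q = fromList⁻ ps q

∑-insert : ∀ {n} i (S : Subset n) f → i ∉ S → ∑ (⁅ i ⁆ ∪ S) f ≡ f i ℤ.+ ∑ S f
∑-insert zero    (inside ∷ S)  f i∉S = ⊥-elim (i∉S here)
∑-insert zero    (outside ∷ S) f i∉S rewrite ∪-identityˡ S = refl
∑-insert (suc i) (inside ∷ S)  f i∉S rewrite ∑-insert i S (f ∘ suc) (i∉S ∘ there) =
  lemma (f zero) (f (suc i)) (∑ S (f ∘ suc))
  where
  lemma : ∀ x y z → x ℤ.+ (y ℤ.+ z) ≡ y ℤ.+ (x ℤ.+ z)
  lemma = solve-∀
∑-insert (suc i) (outside ∷ S) f i∉S = ∑-insert i S (f ∘ suc) (i∉S ∘ there)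

∑ₗ-lincomb : ∀ {n} (l : List (Fin n)) (a b : ℤ) (f g : Fin n → ℤ) →
  ∑ₗ l (λ i → a ℤ.* f i ℤ.+ b ℤ.* g i) ≡ a ℤ.* ∑ₗ l f ℤ.+ b ℤ.* ∑ₗ l g
∑ₗ-lincomb []      a b f g = lemma a b
  where
  lemma : ∀ a b → 0ℤ ≡ a ℤ.* 0ℤ ℤ.+ b ℤ.* 0ℤ
  lemma = solve-∀
∑ₗ-lincomb (i ∷ l) a b f g rewrite ∑ₗ-lincomb l a b f g = lemma a b (f i) (g i) (∑ₗ l f) (∑ₗ l g)
  where
  lemma : ∀ a b x y u v → (a ℤ.* x ℤ.+ b ℤ.* y) ℤ.+ (a ℤ.* u ℤ.+ b ℤ.* v) ≡ a ℤ.* (x ℤ.+ u) ℤ.+ b ℤ.* (y ℤ.+ v)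
  lemma = solve-∀

∑ₗ-++ : ∀ {n} (l m : List (Fin n)) (f : Fin n → ℤ) → ∑ₗ (l ++ m) f ≡ ∑ₗ l f ℤ.+ ∑ₗ m f
∑ₗ-++ []      m f = sym (ℤ.+-identityˡ (∑ₗ m f))
∑ₗ-++ (i ∷ l) m f rewrite ∑ₗ-++ l m f = sym (ℤ.+-assoc (f i) (∑ₗ l f) (∑ₗ m f))

∑-fromList : ∀ {n} {l : List (Fin n)} → Unique l → ∀ f → ∑ (fromList l) f ≡ ∑ₗ l f
∑-fromList []                      f = ∑-⊥ f
∑-fromList {l = i ∷ l} (i∉l ∷ u) f =
  trans (∑-insert i (fromList l) f (λ h → fromList⁻ i∉l h refl)) (cong (ℤ._+_ (f i)) (∑-fromList u f))

∣fromList∣ : ∀ {n} {l : List (Fin n)} → Unique l → ∣ fromList l ∣ ≡ length l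
∣fromList∣ {l = l} u = ℤ.+-injective (trans (sym (∑-1 (fromList l))) (trans (∑-fromList u (λ _ → + 1)) (∑ₗ-1 l)))
  where
  ∑ₗ-1 : ∀ l → ∑ₗ l (λ _ → + 1) ≡ + length l
  ∑ₗ-1 []      = refl
  ∑ₗ-1 (i ∷ l) = cong (ℤ._+_ (+ 1)) (∑ₗ-1 l)

-- Counting by fibres

Σℕ-mono : ∀ m {f g : Fin m → ℕ} → (∀ c → f c ≤ g c) → Σℕ m f ≤ Σℕ m g
Σℕ-mono zero    h = z≤n
Σℕ-mono (suc m) h = +-mono-≤ (h zero) (Σℕ-mono m (h ∘ suc))

0<∣∣⇒∃∈ : ∀ {n} (A : Subset n) → 0 < ∣ A ∣ → ∃ (_∈ A)
0<∣∣⇒∃∈ A h with enumerate 1 A h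
... | f , f∈A , _ = f zero , f∈A zero

-- Fibres may overlap, hence only an inequality. One fibre is removed at a time; what remains is
-- still covered by the others.
∣∣≤Σ-fibres : ∀ {n} m (A : Subset n) {R : Fin m → Fin n → Set} (R? : ∀ c i → Dec (R c i)) →
  (∀ {i} → i ∈ A → ∃ λ c → R c i) → ∣ A ∣ ≤ Σℕ m (λ c → ∣ A ↾ R? c ∣)
∣∣≤Σ-fibres zero    A R? total = ≮⇒≥ λ 0<A → Fin.¬Fin0 (proj₁ (total (proj₂ (0<∣∣⇒∃∈ A 0<A))))
∣∣≤Σ-fibres (suc m) A {R} R? total = ≤-trans (≤-reflexive (∣∣-↾ A (R? zero)))
  (+-monoʳ-≤ ∣ A ↾ R? zero ∣ (≤-trans (∣∣≤Σ-fibres m A′ (R? ∘ suc) total′) (Σℕ-mono m (λ c → p⊆q⇒∣p∣≤∣q∣ (mono c)))))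
  where
  A′ = A ─ (A ↾ R? zero)
  total′ : ∀ {i} → i ∈ A′ → ∃ λ c → R (suc c) i
  total′ i∈A′ with ─↾⁻ A (R? zero) i∈A′
  ... | i∈A , ¬R with total i∈A
  ...   | zero , r  = ⊥-elim (¬R r)
  ...   | suc c , r = c , r
  mono : ∀ c → A′ ↾ R? (suc c) ⊆ A ↾ R? (suc c)
  mono c i∈ with ↾⁻ A′ (R? (suc c)) i∈
  ... | i∈A′ , r = ↾⁺ A (R? (suc c)) (p─q⊆p A (A ↾ R? zero) i∈A′) r

pigeonhole : ∀ {n} m t (A : Subset n) {R : Fin m → Fin n → Set} (R? : ∀ c i → Dec (R c i)) →
  (∀ {i} → i ∈ A → ∃ λ c → R c i) → m * t < ∣ A ∣ → ∃ λ c → t < ∣ A ↾ R? c ∣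
pigeonhole m t A R? total big = Σℕ-large m (λ c → ∣ A ↾ R? c ∣) (<-≤-trans big (∣∣≤Σ-fibres m A R? total))
  where
  Σℕ-large : ∀ m f → m * t < Σℕ m f → ∃ λ c → t < f c
  Σℕ-large (suc m) f h with t <? f zero
  ... | yes t<f = zero , t<f
  ... | no t≮f with Σℕ-large m (f ∘ suc) (+-cancelˡ-< t _ _ (<-≤-trans h (+-monoˡ-≤ _ (≮⇒≥ t≮f))))
  ...   | c , t<f = suc c , t<f

-- The threshold is the floor of (|A| - 1)/(m + 1): a fibre exceeding it has at least |A|/(m + 1)
-- elements. The form without division lets bounds for disjoint parts be added in
-- `popular-hyperplane`.
pigeonhole-average : ∀ {n} m (A : Subset n) {R : Fin (suc m) → Fin n → Set} (R? : ∀ c i → Dec (R c i)) →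
  (∀ {i} → i ∈ A → ∃ λ c → R c i) → ∃ λ c → ∣ A ∣ ≤ suc m * ∣ A ↾ R? c ∣
pigeonhole-average m A R? total with ∣ A ∣ in eq
... | zero  = zero , z≤n
... | suc a with pigeonhole (suc m) (a / suc m) A R? total (≤-trans (s≤s (≤-trans (≤-reflexive (*-comm (suc m) (a / suc m))) (m/n*n≤m a (suc m)))) (≤-reflexive (sym eq)))
...   | c , h = c , ≰⇒> λ k → <⇒≱ (fibre-bound k) h
  where
  fibre-bound : suc m * ∣ A ↾ R? c ∣ ≤ a → ∣ A ↾ R? c ∣ < suc (a / suc m)
  fibre-bound k = s≤s (subst (_≤ a / suc m) (m*n/n≡m ∣ A ↾ R? c ∣ (suc m)) (/-monoˡ-≤ (suc m) (≤-trans (≤-reflexive (*-comm ∣ A ↾ R? c ∣ (suc m))) k)))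

-- Dual to `pigeonhole`: the fibres are disjoint but need not cover `A`, so their sizes add up to at
-- most |A|, and not all can reach t.
sparse-fibre : ∀ {n} m t (A : Subset n) {R : Fin m → Fin n → Set} (R? : ∀ c i → Dec (R c i)) →
  (∀ {i c c′} → i ∈ A → R c i → R c′ i → c ≡ c′) → ∣ A ∣ < m * t → ∃ λ c → ∣ A ↾ R? c ∣ < t
sparse-fibre (suc m) t A {R} R? unique small with ∣ A ↾ R? zero ∣ <? t
... | yes h = zero , h
... | no h with sparse-fibre m t (A ─ (A ↾ R? zero)) (R? ∘ suc)
                  (λ i∈ r r′ → Fin.suc-injective (unique (p─q⊆p A (A ↾ R? zero) i∈) r r′))
                  (+-cancelˡ-< t _ _ (≤-<-trans (≤-trans (+-monoˡ-≤ _ (≮⇒≥ h)) (≤-reflexive (sym (∣∣-↾ A (R? zero))))) small))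
...   | c , h′ = suc c , ≤-<-trans (p⊆q⇒∣p∣≤∣q∣ mono) h′
  where
  mono : A ↾ R? (suc c) ⊆ (A ─ (A ↾ R? zero)) ↾ R? (suc c)
  mono i∈ with ↾⁻ A (R? (suc c)) i∈
  ... | i∈A , r = ↾⁺ _ (R? (suc c)) (x∈p∧x∉q⇒x∈p─q i∈A (λ i∈′ → Fin.0≢1+n (unique i∈A (proj₂ (↾⁻ A (R? zero) i∈′)) r))) r

∉fromList⇒≢ : ∀ {n} (l : List (Fin n)) {i} → i ∉ fromList l → All (i ≢_) l
∉fromList⇒≢ []      i∉ = []
∉fromList⇒≢ (k ∷ l) i∉ = (λ { refl → i∉ (p⊆p∪q (fromList l) (x∈⁅x⁆ k)) }) ∷ ∉fromList⇒≢ l (i∉ ∘ q⊆p∪q ⁅ k ⁆ (fromList l))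

-- Multilinear polynomials on the cube

-- Deg< k f: as a polynomial in the indicator variables of x, f is multilinear of degree less than k.
Deg< : ∀ {n} → ℕ → (Subset n → ℤ) → Set
Deg< zero    f = ∀ x → f x ≡ 0ℤ
Deg< {zero}  (suc k) f = Unit
Deg< {suc n} (suc k) f =
  Deg< (suc k) (λ x → f (outside ∷ x)) × Deg< k (λ x → f (outside ∷ x) ℤ.- f (inside ∷ x))

Deg<-cong : ∀ {n} k {f g : Subset n → ℤ} → (∀ x → f x ≡ g x) → Deg< k f → Deg< k g
Deg<-cong zero            f≗g d = λ x → trans (sym (f≗g x)) (d x)
Deg<-cong {zero}  (suc k) f≗g d = tt
Deg<-cong {suc n} (suc k) f≗g (d , e) =
  Deg<-cong (suc k) (λ x → f≗g (outside ∷ x)) d ,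
  Deg<-cong k (λ x → cong₂ ℤ._-_ (f≗g (outside ∷ x)) (f≗g (inside ∷ x))) e

Deg<-0 : ∀ {n} k {f : Subset n → ℤ} → (∀ x → f x ≡ 0ℤ) → Deg< k f
Deg<-0 zero            f≗0 = f≗0
Deg<-0 {zero}  (suc k) f≗0 = tt
Deg<-0 {suc n} (suc k) f≗0 =
  Deg<-0 (suc k) (λ x → f≗0 (outside ∷ x)) ,
  Deg<-0 k (λ x → cong₂ ℤ._-_ (f≗0 (outside ∷ x)) (f≗0 (inside ∷ x)))

Deg<-mono : ∀ {n k l} {f : Subset n → ℤ} → k ≤ l → Deg< k f → Deg< l f
Deg<-mono {l = l}                   z≤n     d       = Deg<-0 l d
Deg<-mono {zero}                    (s≤s h) d       = tt
Deg<-mono {suc n}                   (s≤s h) (d , e) = Deg<-mono (s≤s h) d , Deg<-mono h e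

Deg<-+ : ∀ {n} k {f g : Subset n → ℤ} → Deg< k f → Deg< k g → Deg< k (λ x → f x ℤ.+ g x)
Deg<-+ zero            d e = λ x → cong₂ ℤ._+_ (d x) (e x)
Deg<-+ {zero}  (suc k) d e = tt
Deg<-+ {suc n} (suc k) {f} {g} (d , d′) (e , e′) =
  Deg<-+ (suc k) d e ,
  Deg<-cong k (λ x → lemma (f (outside ∷ x)) (f (inside ∷ x)) (g (outside ∷ x)) (g (inside ∷ x))) (Deg<-+ k d′ e′)
  where
  lemma : ∀ a b c d → (a ℤ.- b) ℤ.+ (c ℤ.- d) ≡ (a ℤ.+ c) ℤ.- (b ℤ.+ d)
  lemma = solve-∀

Deg<-const : ∀ {n} k c → Deg< {n} (suc k) (λ _ → c)
Deg<-const {zero}  k c = tt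
Deg<-const {suc n} k c = Deg<-const k c , Deg<-0 k (λ _ → ℤ.+-inverseʳ c)

Deg<-neg : ∀ {n} k {f : Subset n → ℤ} → Deg< k f → Deg< k (λ x → ℤ.- f x)
Deg<-neg zero            d       = λ x → cong ℤ.-_ (d x)
Deg<-neg {zero}  (suc k) d       = tt
Deg<-neg {suc n} (suc k) {f} (d , e) =
  Deg<-neg (suc k) d ,
  Deg<-cong k (λ x → ℤ.neg-distrib-+ (f (outside ∷ x)) (ℤ.- f (inside ∷ x))) (Deg<-neg k e)

-- Discrete product rule: with Δf = f₀ - f₁, the difference of the product is f₀ Δg + Δf g₀ - Δf Δg.
-- Strict bounds k and l mean degrees at most k - 1 and l - 1, whence k + l - 1.
Deg<-* : ∀ {n} k l {f g : Subset n → ℤ} → Deg< k f → Deg< l g → Deg< (k + l ∸ 1) (λ x → f x ℤ.* g x)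
Deg<-* zero    l       {f} {g} d e = Deg<-0 (l ∸ 1) (λ x → cong (ℤ._* g x) (d x))
Deg<-* (suc k) zero    {f} {g} d e = Deg<-0 (k + 0) (λ x → trans (cong (f x ℤ.*_) (e x)) (ℤ.*-zeroʳ (f x)))
Deg<-* {zero}  (suc k) (suc l) {f} {g} d e = subst (λ m → Deg< m (λ x → f x ℤ.* g x)) (sym (+-suc k l)) tt
Deg<-* {suc n} (suc k) (suc l) {f} {g} (d , d′) (e , e′) =
  subst (λ m → Deg< m (λ x → f x ℤ.* g x)) (sym (+-suc k l))
  ( subst (λ m → Deg< m (λ x → f₀ x ℤ.* g₀ x)) (+-suc k l) (Deg<-* (suc k) (suc l) d e)
  , Deg<-cong (k + l) (λ x → lemma (f₀ x) (f₁ x) (g₀ x) (g₁ x))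
      (Deg<-+ (k + l)
        (Deg<-+ (k + l)
          (Deg<-* (suc k) l d e′)
          (subst (λ m → Deg< m (λ x → (f₀ x ℤ.- f₁ x) ℤ.* g₀ x)) (cong (_∸ 1) (+-suc k l)) (Deg<-* k (suc l) d′ e)))
        (Deg<-neg (k + l) (Deg<-mono (m∸n≤m (k + l) 1) (Deg<-* k l d′ e′)))))
  where
  f₀ f₁ g₀ g₁ : Subset n → ℤ
  f₀ x = f (outside ∷ x)
  f₁ x = f (inside ∷ x)
  g₀ x = g (outside ∷ x)
  g₁ x = g (inside ∷ x)
  lemma : ∀ a b c d → a ℤ.* (c ℤ.- d) ℤ.+ (a ℤ.- b) ℤ.* c ℤ.+ ℤ.- ((a ℤ.- b) ℤ.* (c ℤ.- d)) ≡ a ℤ.* c ℤ.- b ℤ.* d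
  lemma = solve-∀

Deg<-∑ : ∀ {n} (c : Fin n → ℤ) → Deg< 2 (λ x → ∑ x c)
Deg<-∑ {zero}  c = tt
Deg<-∑ {suc n} c =
  Deg<-∑ (c ∘ suc) ,
  Deg<-cong 1 (λ x → lemma (c zero) (∑ x (c ∘ suc))) (Deg<-const 0 (ℤ.- c zero))
  where
  lemma : ∀ a b → ℤ.- a ≡ b ℤ.- (a ℤ.+ b)
  lemma = solve-∀

-- On the cube, C(|x|, k) is the elementary symmetric polynomial of degree k in the indicator
-- variables; its finite difference is given by Pascal's rule.
Deg<-C : ∀ {n} k → Deg< {n} (suc k) (λ x → + (∣ x ∣ C k))
Deg<-C {zero}  k       = tt
Deg<-C {suc n} zero    = Deg<-C zero , (λ x → refl)
Deg<-C {suc n} (suc k) =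
  Deg<-C (suc k) ,
  Deg<-cong (suc k) (λ x → trans (lemma (+ (∣ x ∣ C k)) (+ (∣ x ∣ C suc k)))
                      (cong (λ m → + (∣ x ∣ C suc k) ℤ.- + m) (nCk+nC[k+1]≡[n+1]C[k+1] ∣ x ∣ k)))
    (Deg<-neg (suc k) (Deg<-C k))
  where
  lemma : ∀ a b → ℤ.- a ≡ b ℤ.- (a ℤ.+ b)
  lemma = solve-∀

altSum : ∀ {n} → Subset n → (Subset n → ℤ) → ℤ
altSum []            f = f []
altSum (outside ∷ A) f = altSum A (λ x → f (outside ∷ x))
altSum (inside ∷ A)  f = altSum A (λ x → f (outside ∷ x) ℤ.- f (inside ∷ x))

-- `Deg<` is built from the same finite differences as `altSum`: each element of `A` uses up one
-- degree, until `Deg< zero` says that the remaining function vanishes.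
altSum≡0 : ∀ {n} (A : Subset n) {f} → Deg< ∣ A ∣ f → altSum A f ≡ 0ℤ
altSum≡0 []            d       = d []
altSum≡0 (inside ∷ A)  (_ , d) = altSum≡0 A d
altSum≡0 (outside ∷ A) {f} d   = altSum≡0 A (restrict ∣ A ∣ d)
  where
  restrict : ∀ k → Deg< k f → Deg< k (λ x → f (outside ∷ x))
  restrict zero    d       = λ x → d (outside ∷ x)
  restrict (suc k) (d , _) = d

altSum≡f⊥ : ∀ {n} m (A : Subset n) {f} → (∀ x → x ⊆ A → 0 < ∣ x ∣ → m ∣ f x) → m ∣ altSum A f ℤ.- f ⊥
altSum≡f⊥ m []            {f} h = divides 0ℤ (ℤ.+-inverseʳ (f []))
altSum≡f⊥ m (outside ∷ A) h = altSum≡f⊥ m A (λ x x⊆A → h (outside ∷ x) (out⊆ x⊆A))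
altSum≡f⊥ m (inside ∷ A)  {f} h =
  subst (m ∣_) (lemma (altSum A (λ x → f (outside ∷ x) ℤ.- f (inside ∷ x))) (f (outside ∷ ⊥)) (f (inside ∷ ⊥)))
    (∣m∣n⇒∣m-n
      (altSum≡f⊥ m A (λ x x⊆A 0<x → ∣m∣n⇒∣m-n (h (outside ∷ x) (out⊆ x⊆A) 0<x) (h (inside ∷ x) (in⊆in x⊆A) (s≤s z≤n))))
      (h (inside ∷ ⊥) (in⊆in ⊥⊆) (s≤s z≤n)))
  where
  lemma : ∀ a b c → a ℤ.- (b ℤ.- c) ℤ.- c ≡ a ℤ.- b
  lemma = solve-∀

∣f⊥ : ∀ {n} m (A : Subset n) {f} → Deg< ∣ A ∣ f → (∀ x → x ⊆ A → 0 < ∣ x ∣ → m ∣ f x) → m ∣ f ⊥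
∣f⊥ m A {f} d h = subst (m ∣_) lemma (∣m∣n⇒∣m-n (divides 0ℤ refl) (altSum≡f⊥ m A h))
  where
  lemma : 0ℤ ℤ.- (altSum A f ℤ.- f ⊥) ≡ f ⊥
  lemma rewrite altSum≡0 A d = lemma′ (f ⊥)
    where
    lemma′ : ∀ a → 0ℤ ℤ.- (0ℤ ℤ.- a) ≡ a
    lemma′ = solve-∀

-- The absorption identity. It exposes a factor from which divisibility of a binomial coefficient by
-- p can be read off.
C-absorb : ∀ n k → suc k * (suc n C suc k) ≡ suc n * (n C k)
C-absorb n zero = trans (cong (1 *_) (nC1≡n (suc n))) (*-comm 1 (suc n))
C-absorb zero    (suc k) = *-comm (suc (suc k)) 0
C-absorb (suc n) (suc k) = begin
  suc (suc k) * (suc (suc n) C suc (suc k))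
    ≡⟨ cong (suc (suc k) *_) (sym (nCk+nC[k+1]≡[n+1]C[k+1] (suc n) (suc k))) ⟩
  suc (suc k) * (a + b)
    ≡⟨ *-distribˡ-+ (suc (suc k)) a b ⟩
  a + suc k * a + suc (suc k) * b
    ≡⟨ cong₂ (λ u v → a + u + v) (C-absorb n k) (C-absorb n (suc k)) ⟩
  a + suc n * (n C k) + suc n * (n C suc k)
    ≡⟨ +-assoc a _ _ ⟩
  a + (suc n * (n C k) + suc n * (n C suc k))
    ≡⟨ cong (_+_ a) (sym (*-distribˡ-+ (suc n) (n C k) (n C suc k))) ⟩
  a + suc n * (n C k + n C suc k)
    ≡⟨ cong (λ u → a + suc n * u) (nCk+nC[k+1]≡[n+1]C[k+1] n k) ⟩
  suc (suc n) * a ∎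
  where
  open ≡-Reasoning
  a = suc n C suc k
  b = suc n C suc (suc k)

+-half : ∀ {b c m} → b + c ≤ suc (m + m) → b ≤ m ⊎ c ≤ m
+-half {b} {c} {m} h with b ≤? m
... | yes b≤m = inj₁ b≤m
... | no b≰m = inj₂ (+-cancelˡ-≤ (suc m) c m (≤-trans (+-monoˡ-≤ c (≰⇒> b≰m)) h))

m<m+n⇒0<n : ∀ m {n} → m < m + n → 0 < n
m<m+n⇒0<n m {n} h = +-cancelˡ-< m 0 n (subst (_< m + n) (sym (+-identityʳ m)) h)

-- Arithmetic and zero-sums modulo p

module ModPrime (q : ℕ) (pr : Prime (suc q)) where

  p : ℕ
  p = suc q

  infix 4 p∣_ p∤_
  p∣_ p∤_ : ℤ → Set
  p∣ a = + p ∣ a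
  p∤ a = ¬ p∣ a

  opaque
    p∣?_ : ∀ a → Dec (p∣ a)
    p∣? a = + p ∣? a

  p>1 : 1 < p
  p>1 = nonTrivial⇒n>1 p {{prime⇒nonTrivial pr}}

  p∣0 : p∣ 0ℤ
  p∣0 = divides 0ℤ refl

  p∣p : p∣ + p
  p∣p = divides (+ 1) (sym (ℤ.*-identityˡ (+ p)))

  euclid : ∀ a b → p∣ a ℤ.* b → p∣ a ⊎ p∣ b
  euclid a b h with euclidsLemma ℤ.∣ a ∣ ℤ.∣ b ∣ pr (subst (p ℕ.∣_) (ℤ.abs-* a b) (∣⇒∣ᵤ h))
  ... | inj₁ h′ = inj₁ (∣ᵤ⇒∣ h′)
  ... | inj₂ h′ = inj₂ (∣ᵤ⇒∣ h′)

  p∤-* : ∀ {a b} → p∤ a → p∤ b → p∤ a ℤ.* b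
  p∤-* {a} {b} h k = [ h , k ]′ ∘ euclid a b

  cancel : ∀ {a b} → p∤ a → p∣ a ℤ.* b → p∣ b
  cancel {a} {b} h k with euclid a b k
  ... | inj₁ h′ = ⊥-elim (h h′)
  ... | inj₂ h′ = h′

  p∤small : ∀ {m} → 0 < m → m < p → p∤ + m
  p∤small {suc m} _ m<p h = <⇒≱ m<p (ℕ.∣⇒≤ (∣⇒∣ᵤ h))

  p∤1 : p∤ + 1
  p∤1 = p∤small (s≤s z≤n) p>1

  opaque
    residue : ∀ a → ∃ λ (c : Fin p) → p∣ a ℤ.- + toℕ c
    residue a = fromℕ< (ℤ.n%ℕd<d a p) , divides (a ℤ./ℕ p) (begin
      a ℤ.- + toℕ (fromℕ< (ℤ.n%ℕd<d a p))
        ≡⟨ cong (λ m → a ℤ.- + m) (Fin.toℕ-fromℕ< (ℤ.n%ℕd<d a p)) ⟩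
      a ℤ.- + (a ℤ.%ℕ p)
        ≡⟨ cong (ℤ._- + (a ℤ.%ℕ p)) (ℤ.a≡a%ℕn+[a/ℕn]*n a p) ⟩
      (+ (a ℤ.%ℕ p) ℤ.+ (a ℤ./ℕ p) ℤ.* + p) ℤ.- + (a ℤ.%ℕ p)
        ≡⟨ lemma (+ (a ℤ.%ℕ p)) _ ⟩
      (a ℤ./ℕ p) ℤ.* + p ∎)
      where
      open ≡-Reasoning
      lemma : ∀ a b → (a ℤ.+ b) ℤ.- a ≡ b
      lemma = solve-∀

  p∣-scale : ∀ {u w} a → p∣ u → w ≡ a ℤ.* u → p∣ w
  p∣-scale a h refl = ∣n⇒∣m*n a h

  p∣-comb : ∀ {u v w} a b → p∣ u → p∣ v → w ≡ a ℤ.* u ℤ.+ b ℤ.* v → p∣ w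
  p∣-comb a b h k refl = ∣m∣n⇒∣m+n (∣n⇒∣m*n a h) (∣n⇒∣m*n b k)

  p∤difference : ∀ {m n} → m < n → n < p → p∤ + n ℤ.- + m
  p∤difference {m} {n} m<n n<p h =
    p∤small (m<n⇒0<n∸m m<n) (≤-<-trans (m∸n≤m n m) n<p)
      (subst p∣_ (trans (ℤ.m-n≡m⊖n n m) (ℤ.⊖-≥ (<⇒≤ m<n))) h)

  residue-unique : ∀ (c c′ : Fin p) → p∣ + toℕ c ℤ.- + toℕ c′ → c ≡ c′
  residue-unique c c′ h with <-cmp (toℕ c) (toℕ c′)
  ... | tri≈ _ eq _ = Fin.toℕ-injective eq
  ... | tri> _ _ gt = ⊥-elim (p∤difference gt (Fin.toℕ<n c) h)
  ... | tri< lt _ _ = ⊥-elim (p∤difference lt (Fin.toℕ<n c′) (p∣-scale (ℤ.- + 1) h (lemma (+ toℕ c) (+ toℕ c′))))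
    where
    lemma : ∀ a b → b ℤ.- a ≡ (ℤ.- + 1) ℤ.* (a ℤ.- b)
    lemma = solve-∀

  opaque
    -- Bézout for p and the residue c of y. The natural coefficients give either z c ≡ -1 or z c ≡ 1
    -- modulo p, so the inverse is -z or z.
    inverse : ∀ y → p∤ y → ∃ λ z → p∣ y ℤ.* z ℤ.- + 1
    inverse y p∤y with residue y
    ... | zero , h = ⊥-elim (p∤y (subst p∣_ (ℤ.+-identityʳ y) h))
    ... | c@(suc _) , h with coprime-Bézout (prime⇒coprime pr (Fin.toℕ<n c))
    ...   | Bézout.Identity.+- x z eq = ℤ.- + z , p∣-comb (ℤ.- + z) (ℤ.- + x) h p∣p
              (lemma y (+ toℕ c) (+ z) (+ x) (+ p) (trans (cong (ℤ._+_ (+ 1)) (sym (ℤ.pos-* z (toℕ c)))) (trans (cong +_ eq) (ℤ.pos-* x p))))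
      where
      lemma : ∀ y c z x p → + 1 ℤ.+ z ℤ.* c ≡ x ℤ.* p →
        y ℤ.* (ℤ.- z) ℤ.- + 1 ≡ (ℤ.- z) ℤ.* (y ℤ.- c) ℤ.+ (ℤ.- x) ℤ.* p
      lemma y c z x p e = trans (eq₁ y c z) (trans (cong (λ w → (ℤ.- z) ℤ.* (y ℤ.- c) ℤ.- w) e) (eq₂ ((ℤ.- z) ℤ.* (y ℤ.- c)) x p))
        where
        eq₁ : ∀ y c z → y ℤ.* (ℤ.- z) ℤ.- + 1 ≡ (ℤ.- z) ℤ.* (y ℤ.- c) ℤ.- (+ 1 ℤ.+ z ℤ.* c)
        eq₁ = solve-∀
        eq₂ : ∀ a x p → a ℤ.- x ℤ.* p ≡ a ℤ.+ (ℤ.- x) ℤ.* p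
        eq₂ = solve-∀
    ...   | Bézout.Identity.-+ x z eq = + z , p∣-comb (+ z) (+ x) h p∣p
              (lemma y (+ toℕ c) (+ z) (+ x) (+ p) (trans (cong (ℤ._+_ (+ 1)) (sym (ℤ.pos-* x p))) (trans (cong +_ eq) (ℤ.pos-* z (toℕ c)))))
      where
      lemma : ∀ y c z x p → + 1 ℤ.+ x ℤ.* p ≡ z ℤ.* c →
        y ℤ.* z ℤ.- + 1 ≡ z ℤ.* (y ℤ.- c) ℤ.+ x ℤ.* p
      lemma y c z x p e = trans (eq₁ y c z) (trans (cong (λ w → z ℤ.* (y ℤ.- c) ℤ.+ w ℤ.- + 1) (sym e)) (eq₂ (z ℤ.* (y ℤ.- c)) (x ℤ.* p)))
        where
        eq₁ : ∀ y c z → y ℤ.* z ℤ.- + 1 ≡ z ℤ.* (y ℤ.- c) ℤ.+ z ℤ.* c ℤ.- + 1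
        eq₁ = solve-∀
        eq₂ : ∀ a b → a ℤ.+ (+ 1 ℤ.+ b) ℤ.- + 1 ≡ a ℤ.+ b
        eq₂ = solve-∀

    solve-linear : ∀ r y → p∤ y → ∃ λ (c : Fin p) → p∣ r ℤ.+ + toℕ c ℤ.* y
    solve-linear r y p∤y with inverse y p∤y
    ... | z , yz≡1 with residue (ℤ.- r ℤ.* z)
    ...   | c , h = c , p∣-comb (ℤ.- r) (ℤ.- y) yz≡1 h (lemma r y z (+ toℕ c))
      where
      lemma : ∀ r y z c → r ℤ.+ c ℤ.* y ≡ (ℤ.- r) ℤ.* (y ℤ.* z ℤ.- + 1) ℤ.+ (ℤ.- y) ℤ.* (ℤ.- r ℤ.* z ℤ.- c)
      lemma = solve-∀

  -- (a - 1)(a - 2)⋯(a - m); for m = p - 1 this detects divisibility of a by p.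
  descend : ℕ → ℤ → ℤ
  descend zero    a = + 1
  descend (suc m) a = (a ℤ.- + suc m) ℤ.* descend m a

  p∣descend : ∀ m {a c} → 0 < c → c ≤ m → p∣ a ℤ.- + c → p∣ descend m a
  p∣descend zero    {c = suc c} _ () h
  p∣descend (suc m) {a} {c} 0<c c≤m h with c ≟ suc m
  ... | yes refl = ∣m⇒∣m*n (descend m a) h
  ... | no c≢    = ∣n⇒∣m*n (a ℤ.- + suc m) (p∣descend m 0<c (≤-pred (≤∧≢⇒< c≤m c≢)) h)

  indicator : ℤ → ℤ
  indicator = descend q

  p∣indicator : ∀ {a} → p∤ a → p∣ indicator a
  p∣indicator {a} p∤a with residue a
  ... | zero , h  = ⊥-elim (p∤a (subst p∣_ (ℤ.+-identityʳ a) h))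
  ... | suc c , h = p∣descend q (s≤s z≤n) (Fin.toℕ<n c) h

  p∤indicator-0 : p∤ indicator 0ℤ
  p∤indicator-0 = go q ≤-refl
    where
    go : ∀ m → m < p → p∤ descend m 0ℤ
    go zero    _   = p∤1
    go (suc m) m<p = p∤-* (λ h → p∤small (s≤s z≤n) m<p (subst p∣_ (lemma (+ suc m)) (∣m⇒∣-m h))) (go m (<⇒≤ m<p))
      where
      lemma : ∀ a → ℤ.- (0ℤ ℤ.- a) ≡ a
      lemma = solve-∀

  Deg<-descend : ∀ {n} m {f : Subset n → ℤ} → Deg< 2 f → Deg< (suc m) (λ x → descend m (f x))
  Deg<-descend zero    d = Deg<-const 0 (+ 1)
  Deg<-descend (suc m) {f} d = Deg<-* 2 (suc m) (Deg<-+ 2 d (Deg<-const 1 (ℤ.- + suc m))) (Deg<-descend m d)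

  p∣C : ∀ {n k} → p ℕ.∣ suc n → suc k < p → p ℕ.∣ suc n C suc k
  p∣C {n} {k} p∣n k<p with euclidsLemma (suc k) (suc n C suc k) pr
                              (subst (p ℕ.∣_) (sym (C-absorb n k)) (ℕ.∣m⇒∣m*n (n C k) p∣n))
  ... | inj₁ h = ⊥-elim (<⇒≱ k<p (ℕ.∣⇒≤ h))
  ... | inj₂ h = h

  -- By Pascal's rule and `p∣C`, C(n, k + 1) ≡ -C(n, k) modulo p; so C(n, k) ≡ (-1)^k for n ≡ -1.
  p∤C : ∀ {n k} → p ℕ.∣ suc n → k < p → ¬ p ℕ.∣ n C k
  p∤C {n} {zero}  p∣n k<p h = <⇒≱ p>1 (ℕ.∣⇒≤ h)
  p∤C {n} {suc k} p∣n k<p h =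
    p∤C p∣n (<⇒≤ k<p) (ℕ.∣m+n∣m⇒∣n (subst (p ℕ.∣_) (trans (sym (nCk+nC[k+1]≡[n+1]C[k+1] n k)) (+-comm (n C k) (n C suc k))) (p∣C p∣n k<p)) h)

  -- Absorption, divided by p, gives C(M p, p) = M C(M p - 1, p - 1) for M = m + 1, and the second
  -- factor is prime to p by `p∤C`.
  p∤C[mp,p] : ∀ {m} → ¬ p ℕ.∣ suc m → ¬ p ℕ.∣ (suc m * p) C p
  p∤C[mp,p] {m} p∤m h with euclidsLemma (suc m) ((q + m * p) C q) pr (subst (p ℕ.∣_) eq h)
    where
    eq : (suc m * p) C p ≡ suc m * ((q + m * p) C q)
    eq = *-cancelˡ-≡ _ _ p (trans (C-absorb (q + m * p) q)
           (trans (cong (_* ((q + m * p) C q)) (*-comm (suc m) p)) (*-assoc p (suc m) _)))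
  ... | inj₁ h′ = p∤m h′
  ... | inj₂ h′ = p∤C (ℕ.divides (suc m) refl) ≤-refl h′

  ZeroSum : ∀ {n d} → (Fin n → Fin d → ℤ) → Subset n → Set
  ZeroSum s S = ∀ j → p∣ ∑ S (λ i → s i j)

  ZeroSum-─ : ∀ {n d} {s : Fin n → Fin d → ℤ} {A B} → B ⊆ A → ZeroSum s A → ZeroSum s B → ZeroSum s (A ─ B)
  ZeroSum-─ {s = s} {A} {B} B⊆A zA zB j = ∣m+n∣m⇒∣n (subst p∣_ (∑-─ A B (λ i → s i j) B⊆A) (zA j)) (zB j)

  Free : ∀ {n d} → (ℕ → Set) → (Fin n → Fin d → ℤ) → Subset n → Set
  Free Small s A = ∀ S → S ⊆ A → 0 < ∣ S ∣ → ZeroSum s S → ¬ Small ∣ S ∣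

  -- Stated as a refutation, which is what the polynomial method and the pigeonhole arguments yield;
  -- a witness is recovered at the end by searching the finitely many subsets.
  Unavoidable : (ℕ → Set) → ℕ → ℕ → Set
  Unavoidable Small d N = ∀ {n} (s : Fin n → Fin d → ℤ) A → N ≤ ∣ A ∣ → ¬ Free Small s A

  -- Knowing the size exactly also bounds the lengths of all zero-sums from above, which leaves only
  -- the multiples of p below 6p in the base cases.
  Unavoidable-exact : ∀ Small {d N} →
    (∀ {n} (s : Fin n → Fin d → ℤ) A → ∣ A ∣ ≡ N → ¬ Free Small s A) → Unavoidable Small d N
  Unavoidable-exact _ {N = N} h s A N≤A free with shrink A N N≤A
  ... | B , B⊆A , eq = h s B eq (λ S S⊆B → free S (B⊆A ∘ S⊆B))

  zeroSumIndicator : ∀ {n} d → (Fin n → Fin d → ℤ) → Subset n → ℤ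
  zeroSumIndicator zero    s x = + 1
  zeroSumIndicator (suc d) s x = indicator (∑ x (λ i → s i zero)) ℤ.* zeroSumIndicator d (λ i j → s i (suc j)) x

  Deg<-zeroSumIndicator : ∀ {n} d (s : Fin n → Fin d → ℤ) → Deg< (suc (d * q)) (zeroSumIndicator d s)
  Deg<-zeroSumIndicator zero    s = Deg<-const 0 (+ 1)
  Deg<-zeroSumIndicator (suc d) s =
    Deg<-mono (≤-reflexive (+-suc q (d * q)))
      (Deg<-* (suc q) (suc (d * q)) (Deg<-descend q (Deg<-∑ (λ i → s i zero))) (Deg<-zeroSumIndicator d (λ i j → s i (suc j))))

  zeroSum⊎p∣ : ∀ {n} d (s : Fin n → Fin d → ℤ) x → ZeroSum s x ⊎ p∣ zeroSumIndicator d s x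
  zeroSum⊎p∣ zero    s x = inj₁ λ ()
  zeroSum⊎p∣ (suc d) s x with p∣? ∑ x (λ i → s i zero)
  ... | no h  = inj₂ (∣m⇒∣m*n (zeroSumIndicator d (λ i j → s i (suc j)) x) (p∣indicator h))
  ... | yes h with zeroSum⊎p∣ d (λ i j → s i (suc j)) x
  ...   | inj₁ k = inj₁ λ { zero → h ; (suc j) → k j }
  ...   | inj₂ k = inj₂ (∣n⇒∣m*n (indicator (∑ x (λ i → s i zero))) k)

  p∤zeroSumIndicator-⊥ : ∀ {n} d (s : Fin n → Fin d → ℤ) → p∤ zeroSumIndicator d s ⊥
  p∤zeroSumIndicator-⊥ zero    s = p∤1
  p∤zeroSumIndicator-⊥ (suc d) s =
    p∤-* (subst (λ a → p∤ indicator a) (sym (∑-⊥ (λ i → s i zero))) p∤indicator-0) (p∤zeroSumIndicator-⊥ d (λ i j → s i (suc j)))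

  -- The product of the zero-sum indicator and g has degree at most d q + e, and would be divisible
  -- by p everywhere except at the empty set. For g = 1 this is Olson's bound d (p - 1) + 1 for a
  -- nonempty zero-sum in F_p^d.
  olson : ∀ {n d} (s : Fin n → Fin d → ℤ) A e {g} → Deg< (suc e) g → p∤ g ⊥ → d * q + e < ∣ A ∣ →
    ¬ (∀ x → x ⊆ A → 0 < ∣ x ∣ → ZeroSum s x → p∣ g x)
  olson {d = d} s A e {g} deg p∤g⊥ big h =
    p∤-* (p∤zeroSumIndicator-⊥ d s) p∤g⊥
      (∣f⊥ (+ p) A
        (Deg<-mono (≤-trans (≤-reflexive (+-suc (d * q) e)) big) (Deg<-* (suc (d * q)) (suc e) (Deg<-zeroSumIndicator d s) deg))
        (λ x x⊆A 0<x → [ (λ z → ∣n⇒∣m*n (zeroSumIndicator d s x) (h x x⊆A 0<x z)) , ∣m⇒∣m*n (g x) ]′ (zeroSum⊎p∣ d s x)))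

  -- `B` is sought inside a proper subset of `Z`, so it cannot be all of `Z`, and its complement is
  -- a nonempty zero-sum too. The factor g restricts which `B` need to be considered.
  split : ∀ {n d} (s : Fin n → Fin d → ℤ) Z → ZeroSum s Z → ∀ e {g} → Deg< (suc e) g → p∤ g ⊥ → suc (d * q + e) < ∣ Z ∣ →
    ¬ (∀ B → B ⊆ Z → 0 < ∣ B ∣ → 0 < ∣ Z ─ B ∣ → ZeroSum s B → ZeroSum s (Z ─ B) → ∣ B ∣ + ∣ Z ─ B ∣ ≡ ∣ Z ∣ → p∣ g B)
  split {d = d} s Z zZ e deg p∤g⊥ big h with shrink Z (suc (d * q + e)) (<⇒≤ big)
  ... | Z′ , Z′⊆Z , eq = olson s Z′ e deg p∤g⊥ (≤-reflexive (sym eq)) λ B B⊆Z′ 0<B zB →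
    let B⊆Z = λ {i} (i∈B : i ∈ B) → Z′⊆Z (B⊆Z′ i∈B)
        sizes = sym (∣∣-─ Z B B⊆Z)
        B<Z = ≤-<-trans (≤-trans (p⊆q⇒∣p∣≤∣q∣ B⊆Z′) (≤-reflexive eq)) big
    in h B B⊆Z 0<B (m<m+n⇒0<n ∣ B ∣ (subst (∣ B ∣ <_) (sym sizes) B<Z))
         zB (ZeroSum-─ {s = s} B⊆Z zZ zB) sizes

  lengthIndicator : ∀ {n} → Subset n → ℤ
  lengthIndicator x = indicator (+ ∣ x ∣)

  Deg<-lengthIndicator : ∀ {n} → Deg< {n} (suc q) lengthIndicator
  Deg<-lengthIndicator = Deg<-descend q (Deg<-cong 2 ∑-1 (Deg<-∑ (λ _ → + 1)))

  p∤lengthIndicator-⊥ : ∀ n → p∤ lengthIndicator {n} ⊥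
  p∤lengthIndicator-⊥ n = subst (λ m → p∤ indicator (+ m)) (sym (∣⊥∣≡0 n)) p∤indicator-0

  multiple⊎p∣lengthIndicator : ∀ {n} (x : Subset n) → (∃ λ k → ∣ x ∣ ≡ k * p) ⊎ p∣ lengthIndicator x
  multiple⊎p∣lengthIndicator x with p ℕ.∣? ∣ x ∣
  ... | yes (ℕ.divides k eq) = inj₁ (k , eq)
  ... | no h = inj₂ (p∣indicator (h ∘ ∣⇒∣ᵤ))

  -- By Lucas' theorem C(k p, p) ≡ k modulo p, so at length k p this is k - m modulo p: a polynomial
  -- of degree p that tells multiples of p apart.
  lengthExclude : ∀ {n} → ℕ → Subset n → ℤ
  lengthExclude m x = + (∣ x ∣ C p) ℤ.- + ((m * p) C p)

  Deg<-lengthExclude : ∀ {n} m → Deg< {n} (suc p) (lengthExclude m)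
  Deg<-lengthExclude m = Deg<-+ (suc p) (Deg<-C p) (Deg<-const p (ℤ.- + ((m * p) C p)))

  p∣lengthExclude : ∀ {n} m (x : Subset n) → ∣ x ∣ ≡ m * p → p∣ lengthExclude m x
  p∣lengthExclude m x eq rewrite eq = subst p∣_ (sym (ℤ.+-inverseʳ (+ ((m * p) C p)))) p∣0

  p∤lengthExclude-⊥ : ∀ n m → ¬ p ℕ.∣ suc m → p∤ lengthExclude {n} (suc m) ⊥
  p∤lengthExclude-⊥ n m p∤m h rewrite ∣⊥∣≡0 n =
    p∤C[mp,p] p∤m (∣⇒∣ᵤ (subst p∣_ (lemma (+ ((suc m * p) C p))) (∣m⇒∣-m h)))
    where
    lemma : ∀ a → ℤ.- (0ℤ ℤ.- a) ≡ a
    lemma = solve-∀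

  -- The base cases: dimension 3 and dimension 4

  -- The bound (3p - 1)/2 is cleared of its denominator, so p = 2 needs no rounding.
  Small₁ Small₂ : ℕ → Set
  Small₁ ℓ = 2 * ℓ ≤ 3 * p ∸ 1
  Small₂ ℓ = ℓ ≤ 2 * p

  size<6p : ∀ {m} k → m ≤ suc (6 * q + 2) → m ≢ (6 + k) * p
  size<6p k m≤ refl = <⇒≱ (subst (suc (suc (6 * q + 2)) ≤_) (lemma q) (m≤m+n _ 2))
    (≤-trans (≤-trans (m≤m+n (6 * p) (k * p)) (≤-reflexive (sym (*-distribʳ-+ p 6 k)))) m≤)
    where
    lemma : ∀ q → suc (suc (6 * q + 2)) + 2 ≡ 6 * suc q
    lemma = ℕ-solve-∀

  -- The odd prime is written p = 2h + 3, which makes (3p - 1)/2 the integer 3h + 4.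
  module Base₁ (h : ℕ) (q≡2h : q ≡ suc h + suc h) {n} (s : Fin n → Fin 3 → ℤ) (A : Subset n) (size : ∣ A ∣ ≡ suc (6 * q + 2)) (free : Free Small₁ s A) where

    3p∸1 : 3 * p ∸ 1 ≡ 2 * (3 * h + 4)
    3p∸1 rewrite q≡2h = lemma h
      where
      lemma : ∀ h → suc h + suc h + (suc (suc h + suc h) + (suc (suc h + suc h) + 0)) ≡ 2 * (3 * h + 4)
      lemma = ℕ-solve-∀

    2<p : 2 < p
    2<p rewrite q≡2h = s≤s (s≤s (subst (1 ≤_) (sym (+-suc h h)) (s≤s z≤n)))

    p∤2 : ¬ p ℕ.∣ 2
    p∤2 k = <⇒≱ 2<p (ℕ.∣⇒≤ k)

    p∤4 : ¬ p ℕ.∣ 4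
    p∤4 k = [ p∤2 , p∤2 ]′ (euclidsLemma 2 2 pr k)

    small : ∀ ℓ → ℓ ≤ 3 * h + 4 → Small₁ ℓ
    small ℓ k rewrite 3p∸1 = *-monoʳ-≤ 2 k

    no-p : ∀ Z → Z ⊆ A → ZeroSum s Z → ∣ Z ∣ ≢ 1 * p
    no-p Z Z⊆A zZ eq = free Z Z⊆A (subst (0 <_) (sym eq) (s≤s z≤n)) zZ (small ∣ Z ∣ (subst (_≤ 3 * h + 4) (sym eq) p≤))
      where
      p≤ : 1 * p ≤ 3 * h + 4
      p≤ rewrite q≡2h = subst (1 * suc (suc h + suc h) ≤_) (lemma h) (m≤m+n _ (suc h))
        where
        lemma : ∀ h → 1 * suc (suc h + suc h) + suc h ≡ 3 * h + 4
        lemma = ℕ-solve-∀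

    -- Since 3p = 2 (3h + 4) + 1, one of the two parts of any splitting has at most 3h + 4 = (3p -
    -- 1)/2 terms. A splitting exists because 3q + 1 < 3p.
    no-3p : ∀ Z → Z ⊆ A → ZeroSum s Z → ∣ Z ∣ ≢ 3 * p
    no-3p Z Z⊆A zZ eq = split s Z zZ 0 (Deg<-const 0 (+ 1)) p∤1 (subst (suc (3 * q + 0) <_) (sym eq) big)
      λ B B⊆Z 0<B 0<Z─B zB zZ─B sizes → ⊥-elim
        ([ free B (Z⊆A ∘ B⊆Z) 0<B zB ∘ small ∣ B ∣ , free (Z ─ B) (Z⊆A ∘ p─q⊆p Z B) 0<Z─B zZ─B ∘ small ∣ Z ─ B ∣ ]′
          (+-half (≤-reflexive (trans sizes (trans eq (cong suc (trans 3p∸1 (lemma h))))))))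
      where
      big : suc (3 * q + 0) < 3 * p
      big = subst (_≤ 3 * p) (lemma₁ q) (subst (3 * q + 2 ≤_) (lemma₂ q) (n≤1+n _))
        where
        lemma₁ : ∀ q → 3 * q + 2 ≡ suc (suc (3 * q + 0))
        lemma₁ = ℕ-solve-∀
        lemma₂ : ∀ q → suc (3 * q + 2) ≡ 3 * suc q
        lemma₂ = ℕ-solve-∀
      lemma : ∀ h → 2 * (3 * h + 4) ≡ 3 * h + 4 + (3 * h + 4)
      lemma = ℕ-solve-∀

    -- The length indicator is affordable, as 4q + 1 < 5p, and makes both parts multiples of p. Each
    -- of 1 + 4 and 2 + 3 contains an already excluded length p or 3p.
    no-5p : ∀ Z → Z ⊆ A → ZeroSum s Z → ∣ Z ∣ ≢ 5 * p
    no-5p Z Z⊆A zZ eq = split s Z zZ q Deg<-lengthIndicator (p∤lengthIndicator-⊥ n) (subst (suc (3 * q + q) <_) (sym eq) big)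
      λ B B⊆Z 0<B 0<Z─B zB zZ─B sizes →
        [ (λ (k , eqB) → ⊥-elim (cases k B (Z ─ B) (Z⊆A ∘ B⊆Z) (Z⊆A ∘ p─q⊆p Z B) 0<B 0<Z─B zB zZ─B (trans sizes eq) eqB)) , id ]′
          (multiple⊎p∣lengthIndicator B)
      where
      big : suc (3 * q + q) < 5 * p
      big = subst (suc (suc (3 * q + q)) ≤_) (lemma q) (m≤m+n _ (q + 3))
        where
        lemma : ∀ q → suc (suc (3 * q + q)) + (q + 3) ≡ 5 * suc q
        lemma = ℕ-solve-∀
      cases : ∀ k B B′ → B ⊆ A → B′ ⊆ A → 0 < ∣ B ∣ → 0 < ∣ B′ ∣ → ZeroSum s B → ZeroSum s B′ →
        ∣ B ∣ + ∣ B′ ∣ ≡ 5 * p → ∣ B ∣ ≡ k * p → Empty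
      cases 0 B B′ B⊆A B′⊆A 0<B 0<B′ zB zB′ sizes eqB = <⇒≢ 0<B (sym eqB)
      cases 1 B B′ B⊆A B′⊆A 0<B 0<B′ zB zB′ sizes eqB = no-p B B⊆A zB eqB
      cases 2 B B′ B⊆A B′⊆A 0<B 0<B′ zB zB′ sizes eqB = no-3p B′ B′⊆A zB′ (+-cancelˡ-≡ (2 * p) _ _ (trans (cong (_+ ∣ B′ ∣) (sym eqB)) (trans sizes (*-distribʳ-+ p 2 3))))
      cases 3 B B′ B⊆A B′⊆A 0<B 0<B′ zB zB′ sizes eqB = no-3p B B⊆A zB eqB
      cases 4 B B′ B⊆A B′⊆A 0<B 0<B′ zB zB′ sizes eqB = no-p B′ B′⊆A zB′ (+-cancelˡ-≡ (4 * p) _ _ (trans (cong (_+ ∣ B′ ∣) (sym eqB)) (trans sizes (*-distribʳ-+ p 4 1))))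
      cases (suc (suc (suc (suc (suc k))))) B B′ B⊆A B′⊆A 0<B 0<B′ zB zB′ sizes eqB =
        <⇒≱ (+-monoʳ-< ∣ B ∣ 0<B′) (≤-trans (≤-reflexive sizes) (≤-trans (≤-trans (m≤m+n (5 * p) (k * p)) (≤-reflexive (trans (sym (*-distribʳ-+ p 5 k)) (sym eqB)))) (m≤m+n ∣ B ∣ 0)))

    contra : Empty
    contra = olson s A (q + (p + p))
        (Deg<-mono (≤-reflexive (lemma₁ q p))
          (Deg<-* (suc q) (suc p + suc p ∸ 1) Deg<-lengthIndicator
            (Deg<-* (suc p) (suc p) (Deg<-lengthExclude 2) (Deg<-lengthExclude 4))))
        (p∤-* (p∤lengthIndicator-⊥ n) (p∤-* (p∤lengthExclude-⊥ n 1 p∤2) (p∤lengthExclude-⊥ n 3 p∤4)))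
        (≤-reflexive (trans (cong suc (lemma₂ q)) (sym size)))
        λ x x⊆A 0<x zx →
          [ (λ (k , eq) → ∣n⇒∣m*n (lengthIndicator x) (cases k x x⊆A 0<x zx eq))
          , ∣m⇒∣m*n (lengthExclude 2 x ℤ.* lengthExclude 4 x) ]′ (multiple⊎p∣lengthIndicator x)
      where
      lemma₁ : ∀ q p → suc q + (suc p + suc p ∸ 1) ∸ 1 ≡ suc (q + (p + p))
      lemma₁ q p = trans (cong (_+_ q) (+-suc p p)) (+-suc q (p + p))
      lemma₂ : ∀ q → 3 * q + (q + (suc q + suc q)) ≡ 6 * q + 2
      lemma₂ = ℕ-solve-∀
      cases : ∀ k x → x ⊆ A → 0 < ∣ x ∣ → ZeroSum s x → ∣ x ∣ ≡ k * p → p∣ lengthExclude 2 x ℤ.* lengthExclude 4 x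
      cases 0 x x⊆A 0<x zx eq = contradiction (sym eq) (<⇒≢ 0<x)
      cases 1 x x⊆A 0<x zx eq = contradiction eq (no-p x x⊆A zx)
      cases 2 x x⊆A 0<x zx eq = ∣m⇒∣m*n (lengthExclude 4 x) (p∣lengthExclude 2 x eq)
      cases 3 x x⊆A 0<x zx eq = contradiction eq (no-3p x x⊆A zx)
      cases 4 x x⊆A 0<x zx eq = ∣n⇒∣m*n (lengthExclude 2 x) (p∣lengthExclude 4 x eq)
      cases 5 x x⊆A 0<x zx eq = contradiction eq (no-5p x x⊆A zx)
      cases (suc (suc (suc (suc (suc (suc k)))))) x x⊆A 0<x zx eq =
        contradiction eq (size<6p k (subst (∣ x ∣ ≤_) size (p⊆q⇒∣p∣≤∣q∣ x⊆A)))

  base₁ : ∀ {h} → q ≡ suc h + suc h → Unavoidable Small₁ 3 (suc (6 * q + 2))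
  base₁ {h} q≡2h = Unavoidable-exact Small₁ λ s A size free → Base₁.contra h q≡2h s A size free

  module Base₂ (p∤3 : ¬ p ℕ.∣ 3) {n} (s : Fin n → Fin 4 → ℤ) (A : Subset n) (size : ∣ A ∣ ≡ suc (6 * q + 2)) (free : Free Small₂ s A) where

    no-p-2p : ∀ k Z → Z ⊆ A → 0 < ∣ Z ∣ → ZeroSum s Z → k ≤ 2 → ∣ Z ∣ ≢ k * p
    no-p-2p k Z Z⊆A 0<Z zZ k≤2 eq = free Z Z⊆A 0<Z zZ (≤-trans (≤-reflexive eq) (*-monoˡ-≤ p k≤2))

    -- One of two parts of 4p terms has at most 2p terms; 4q + 1 < 4p leaves room for a splitting.
    no-4p : ∀ Z → Z ⊆ A → ZeroSum s Z → ∣ Z ∣ ≢ 4 * p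
    no-4p Z Z⊆A zZ eq = split s Z zZ 0 (Deg<-const 0 (+ 1)) p∤1 (subst (suc (4 * q + 0) <_) (sym eq) big)
      λ B B⊆Z 0<B 0<Z─B zB zZ─B sizes → ⊥-elim
        ([ free B (Z⊆A ∘ B⊆Z) 0<B zB , free (Z ─ B) (Z⊆A ∘ p─q⊆p Z B) 0<Z─B zZ─B ]′
          (+-half (≤-trans (≤-reflexive (trans sizes (trans eq (lemma p)))) (n≤1+n _))))
      where
      big : suc (4 * q + 0) < 4 * p
      big = subst (suc (suc (4 * q + 0)) ≤_) (lemma₁ q) (m≤m+n _ 2)
        where
        lemma₁ : ∀ q → suc (suc (4 * q + 0)) + 2 ≡ 4 * suc q
        lemma₁ = ℕ-solve-∀
      lemma : ∀ p → 4 * p ≡ 2 * p + 2 * p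
      lemma = ℕ-solve-∀

    -- Arbitrary parts could both exceed 2p. With lengths that are multiples of p, one part has at
    -- most 2p terms; the degree 4q + q still fits.
    no-5p : ∀ Z → Z ⊆ A → ZeroSum s Z → ∣ Z ∣ ≢ 5 * p
    no-5p Z Z⊆A zZ eq = split s Z zZ q Deg<-lengthIndicator (p∤lengthIndicator-⊥ n) (subst (suc (4 * q + q) <_) (sym eq) big)
      λ B B⊆Z 0<B 0<Z─B zB zZ─B sizes →
        [ (λ (k , eqB) → ⊥-elim (cases k B (Z ─ B) (Z⊆A ∘ B⊆Z) (Z⊆A ∘ p─q⊆p Z B) 0<B 0<Z─B zB zZ─B (trans sizes eq) eqB)) , id ]′
          (multiple⊎p∣lengthIndicator B)
      where
      big : suc (4 * q + q) < 5 * p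
      big = subst (suc (suc (4 * q + q)) ≤_) (lemma q) (m≤m+n _ 3)
        where
        lemma : ∀ q → suc (suc (4 * q + q)) + 3 ≡ 5 * suc q
        lemma = ℕ-solve-∀
      cases : ∀ k B B′ → B ⊆ A → B′ ⊆ A → 0 < ∣ B ∣ → 0 < ∣ B′ ∣ → ZeroSum s B → ZeroSum s B′ →
        ∣ B ∣ + ∣ B′ ∣ ≡ 5 * p → ∣ B ∣ ≡ k * p → Empty
      cases 0 B B′ B⊆A B′⊆A 0<B 0<B′ zB zB′ sizes eqB = <⇒≢ 0<B (sym eqB)
      cases 1 B B′ B⊆A B′⊆A 0<B 0<B′ zB zB′ sizes eqB = no-p-2p 1 B B⊆A 0<B zB (s≤s z≤n) eqB
      cases 2 B B′ B⊆A B′⊆A 0<B 0<B′ zB zB′ sizes eqB = no-p-2p 2 B B⊆A 0<B zB ≤-refl eqB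
      cases (suc (suc (suc k))) B B′ B⊆A B′⊆A 0<B 0<B′ zB zB′ sizes eqB =
        free B′ B′⊆A 0<B′ zB′ (+-cancelˡ-≤ (3 * p) _ _
          (≤-trans (+-monoˡ-≤ ∣ B′ ∣ (≤-trans (m≤m+n (3 * p) (k * p)) (≤-reflexive (trans (sym (*-distribʳ-+ p 3 k)) (sym eqB)))))
                   (≤-reflexive (trans sizes (*-distribʳ-+ p 3 2)))))

    contra : Empty
    contra = olson s A (q + p)
        (Deg<-mono (≤-reflexive (+-suc q p)) (Deg<-* (suc q) (suc p) Deg<-lengthIndicator (Deg<-lengthExclude 3)))
        (p∤-* (p∤lengthIndicator-⊥ n) (p∤lengthExclude-⊥ n 2 p∤3))
        (≤-trans (≤-trans (n≤1+n _) (≤-reflexive (cong suc (lemma₂ q)))) (≤-reflexive (sym size)))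
        λ x x⊆A 0<x zx →
          [ (λ (k , eq) → ∣n⇒∣m*n (lengthIndicator x) (cases k x x⊆A 0<x zx eq))
          , ∣m⇒∣m*n (lengthExclude 3 x) ]′ (multiple⊎p∣lengthIndicator x)
      where
      lemma₂ : ∀ q → suc (4 * q + (q + suc q)) ≡ 6 * q + 2
      lemma₂ = ℕ-solve-∀
      cases : ∀ k x → x ⊆ A → 0 < ∣ x ∣ → ZeroSum s x → ∣ x ∣ ≡ k * p → p∣ lengthExclude 3 x
      cases 0 x x⊆A 0<x zx eq = contradiction (sym eq) (<⇒≢ 0<x)
      cases 1 x x⊆A 0<x zx eq = contradiction eq (no-p-2p 1 x x⊆A 0<x zx (s≤s z≤n))
      cases 2 x x⊆A 0<x zx eq = contradiction eq (no-p-2p 2 x x⊆A 0<x zx ≤-refl)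
      cases 3 x x⊆A 0<x zx eq = p∣lengthExclude 3 x eq
      cases 4 x x⊆A 0<x zx eq = contradiction eq (no-4p x x⊆A zx)
      cases 5 x x⊆A 0<x zx eq = contradiction eq (no-5p x x⊆A zx)
      cases (suc (suc (suc (suc (suc (suc k)))))) x x⊆A 0<x zx eq =
        contradiction eq (size<6p k (subst (∣ x ∣ ≤_) size (p⊆q⇒∣p∣≤∣q∣ x⊆A)))

  base₂ : ¬ p ℕ.∣ 3 → Unavoidable Small₂ 4 (suc (6 * q + 2))
  base₂ p∤3 = Unavoidable-exact Small₂ λ s A size free → Base₂.contra p∤3 s A size free

  -- Raising the dimension

  V : ℕ → Set
  V d = Fin d → ℤ

  Zero : ∀ {d} → V d → Set
  Zero v = ∀ j → p∣ v j

  Zero? : ∀ {d} (v : V d) → Dec (Zero v)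
  Zero? v = Fin.all? (λ j → p∣? v j)

  dot : ∀ {d} → V d → V d → ℤ
  dot {zero}  c v = 0ℤ
  dot {suc d} c v = c zero ℤ.* v zero ℤ.+ dot (c ∘ suc) (v ∘ suc)

  p∣∑dot : ∀ {n d} (S : Subset n) (c : V d) (y : Fin n → V d) → ZeroSum y S → p∣ ∑ S (λ i → dot c (y i))
  p∣∑dot {d = zero}  S c y z = ∣∑ S (λ _ → p∣0)
  p∣∑dot {d = suc d} S c y z = subst p∣_ (sym eq)
    (∣m∣n⇒∣m+n (∣n⇒∣m*n (c zero) (z zero)) (∣n⇒∣m*n (+ 1) (p∣∑dot S (c ∘ suc) (λ i → y i ∘ suc) (z ∘ suc))))
    where
    f g : _ → ℤ
    f i = y i zero
    g i = dot (c ∘ suc) (y i ∘ suc)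
    eq : ∑ S (λ i → dot c (y i)) ≡ c zero ℤ.* ∑ S f ℤ.+ + 1 ℤ.* ∑ S g
    eq = trans (∑-cong S (λ i → cong (ℤ._+_ (c zero ℤ.* f i)) (sym (ℤ.*-identityˡ (g i))))) (∑-lincomb S (c zero) (+ 1) f g)

  -- With `r i` the pivot coordinate of a term and `y i` its class modulo ⟨e⟩, r + c · y = 0 is the
  -- general hyperplane avoiding e. An arbitrary offset r is what the induction on coordinates
  -- needs.
  OnHyperplane? : ∀ {n d} (r : Fin n → ℤ) (y : Fin n → V d) (c : V d) i → Dec (p∣ r i ℤ.+ dot c (y i))
  OnHyperplane? r y c i = p∣? (r i ℤ.+ dot c (y i))

  infixr 5 _∷ᵥ_
  _∷ᵥ_ : ∀ {d} → ℤ → V d → V (suc d)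
  (a ∷ᵥ v) zero    = a
  (a ∷ᵥ v) (suc j) = v j

  p∣dot : ∀ {d} (c : V d) {v} → Zero v → p∣ dot c v
  p∣dot {zero}  c t = p∣0
  p∣dot {suc d} c t = ∣m∣n⇒∣m+n (∣n⇒∣m*n (c zero) (t zero)) (p∣dot (c ∘ suc) (t ∘ suc))

  module _ {n d} (A : Subset n) (r : Fin n → ℤ) (y : Fin n → V (suc d)) where

    tailZero? : ∀ i → Dec (Zero (y i ∘ suc))
    tailZero? i = Zero? (y i ∘ suc)

    degenerate generic : Subset n
    degenerate = A ↾ tailZero?
    generic = A ─ degenerate

    shifted : ℤ → Fin n → ℤ
    shifted a i = r i ℤ.+ a ℤ.* y i zero

    -- A degenerate term sees only the first coefficient `a`; for a generic one `a` is absorbed into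
    -- the offset. So the two counts add up on a single hyperplane.
    ∣hyperplane∣ : ∀ a (c : V d) →
      ∣ degenerate ↾ (λ i → p∣? shifted a i) ∣ + ∣ generic ↾ OnHyperplane? (shifted a) (λ i → y i ∘ suc) c ∣
        ≤ ∣ A ↾ OnHyperplane? r y (a ∷ᵥ c) ∣
    ∣hyperplane∣ a c = ∣∣-disjoint part₀ part₁ λ i∈ i∈′ → ∉-─ A degenerate (↾-⊆ generic _ i∈) (↾-⊆ degenerate _ i∈′)
      where
      part₀ : degenerate ↾ (λ i → p∣? shifted a i) ⊆ A ↾ OnHyperplane? r y (a ∷ᵥ c)
      part₀ {i} i∈ with ↾⁻ degenerate (λ i → p∣? shifted a i) i∈
      ... | i∈degenerate , h with ↾⁻ A tailZero? i∈degenerate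
      ...   | i∈A , t = ↾⁺ A (OnHyperplane? r y (a ∷ᵥ c)) i∈A
                (subst p∣_ (ℤ.+-assoc (r i) (a ℤ.* y i zero) (dot c (y i ∘ suc))) (∣m∣n⇒∣m+n h (p∣dot c t)))
      part₁ : generic ↾ OnHyperplane? (shifted a) (λ i → y i ∘ suc) c ⊆ A ↾ OnHyperplane? r y (a ∷ᵥ c)
      part₁ {i} i∈ with ↾⁻ generic (OnHyperplane? (shifted a) (λ i → y i ∘ suc) c) i∈
      ... | i∈generic , h = ↾⁺ A (OnHyperplane? r y (a ∷ᵥ c)) (p─q⊆p A degenerate i∈generic)
                (subst p∣_ (ℤ.+-assoc (r i) (a ℤ.* y i zero) (dot c (y i ∘ suc))) h)

  -- The coordinates of c are chosen one at a time: c₀ serves the indices for which y i vanishes beyond coordinate 0,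
  -- the remaining coordinates serve the other indices.
  popular-hyperplane : ∀ {n} d (A : Subset n) (r : Fin n → ℤ) (y : Fin n → V d) → (∀ {i} → i ∈ A → ¬ Zero (y i)) →
    ∃ λ c → ∣ A ∣ ≤ p * ∣ A ↾ OnHyperplane? r y c ∣
  popular-hyperplane zero    A r y nz = (λ ()) , ≮⇒≥ λ h → nz (proj₂ (0<∣∣⇒∃∈ A (≤-<-trans z≤n h))) (λ ())
  popular-hyperplane (suc d) A r y nz = assemble (pigeonhole-average q (degenerate A r y) R? total)
    where
    R? : ∀ (c : Fin p) i → Dec (p∣ shifted A r y (+ toℕ c) i)
    R? c i = p∣? shifted A r y (+ toℕ c) i
    total : ∀ {i} → i ∈ degenerate A r y → ∃ λ (c : Fin p) → p∣ shifted A r y (+ toℕ c) i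
    total {i} i∈ = solve-linear (r i) (y i zero) λ h → nz (↾-⊆ A (tailZero? A r y) i∈)
      λ { zero → h ; (suc j) → proj₂ (↾⁻ A (tailZero? A r y) i∈) j }
    tail : Fin _ → V d
    tail i = y i ∘ suc
    assemble : (∃ λ c → ∣ degenerate A r y ∣ ≤ p * ∣ degenerate A r y ↾ R? c ∣) → ∃ λ c → ∣ A ∣ ≤ p * ∣ A ↾ OnHyperplane? r y c ∣
    assemble (c₀ , bound₀) = extend (popular-hyperplane d (generic A r y) (shifted A r y (+ toℕ c₀)) tail (λ i∈ → proj₂ (─↾⁻ A (tailZero? A r y) i∈)))
      where
      extend : (∃ λ c → ∣ generic A r y ∣ ≤ p * ∣ generic A r y ↾ OnHyperplane? (shifted A r y (+ toℕ c₀)) tail c ∣) → ∃ λ c → ∣ A ∣ ≤ p * ∣ A ↾ OnHyperplane? r y c ∣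
      extend (c , bound₁) = + toℕ c₀ ∷ᵥ c , (begin
        ∣ A ∣
          ≡⟨ ∣∣-↾ A (tailZero? A r y) ⟩
        ∣ degenerate A r y ∣ + ∣ generic A r y ∣
          ≤⟨ +-mono-≤ bound₀ bound₁ ⟩
        p * m₀ + p * m₁
          ≡⟨ sym (*-distribˡ-+ p m₀ m₁) ⟩
        p * (m₀ + m₁)
          ≤⟨ *-monoʳ-≤ p (∣hyperplane∣ A r y (+ toℕ c₀) c) ⟩
        p * ∣ A ↾ OnHyperplane? r y (+ toℕ c₀ ∷ᵥ c) ∣ ∎)
        where
        open ≤-Reasoning
        m₀ = ∣ degenerate A r y ↾ R? c₀ ∣
        m₁ = ∣ generic A r y ↾ OnHyperplane? (shifted A r y (+ toℕ c₀)) tail c ∣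

  -- Coordinates on the quotient by the line spanned by e, where e k ≢ 0.
  quotient : ∀ {d} → V (suc d) → Fin (suc d) → V (suc d) → V d
  quotient e k x j = e k ℤ.* x (punchIn k j) ℤ.+ ℤ.- e (punchIn k j) ℤ.* x k

  -- A sum that vanishes in the quotient is a multiple of e, and the pivot coordinate tells which
  -- multiple.
  ZeroSum-quotient : ∀ {n d} (e : V (suc d)) k → p∤ e k → (s : Fin n → V (suc d)) (S : Subset n) →
    ZeroSum (quotient e k ∘ s) S → p∣ ∑ S (λ i → s i k) → ZeroSum s S
  ZeroSum-quotient e k p∤ek s S z zk j with k Fin.≟ j
  ... | yes refl = zk
  ... | no k≢j = cancel p∤ek (p∣-comb (+ 1) (e j) zj zk
           (lemma (e k) (e j) (∑ S (λ i → s i j)) (∑ S (λ i → s i k))))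
    where
    zj : p∣ e k ℤ.* ∑ S (λ i → s i j) ℤ.+ ℤ.- e j ℤ.* ∑ S (λ i → s i k)
    zj = subst p∣_ (∑-lincomb S (e k) (ℤ.- e j) (λ i → s i j) (λ i → s i k))
           (subst (λ l → p∣ ∑ S (λ i → e k ℤ.* s i l ℤ.+ ℤ.- e l ℤ.* s i k)) (Fin.punchIn-punchOut k≢j) (z (punchOut k≢j)))
    lemma : ∀ a b x y → a ℤ.* x ≡ + 1 ℤ.* (a ℤ.* x ℤ.+ ℤ.- b ℤ.* y) ℤ.+ b ℤ.* y
    lemma = solve-∀

  -- A hyperplane avoiding e maps isomorphically onto the quotient by ⟨e⟩: on it the pivot
  -- coordinate is a linear function of the class. So a zero-sum found in the quotient is already a
  -- zero-sum.
  step : ∀ {Small d M} → Unavoidable Small d (suc M) → ∀ {n} (s : Fin n → V (suc d)) A (e : V (suc d)) k → p∤ e k →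
    (∀ {i} → i ∈ A → ¬ Zero (quotient e k (s i))) → M * p < ∣ A ∣ → ¬ Free Small s A
  step {d = d} {M} unav s A e k p∤ek missed big free with popular-hyperplane d A (λ i → s i k) (quotient e k ∘ s) missed
  ... | c , bound = unav (quotient e k ∘ s) B (*-cancelˡ-< p M ∣ B ∣ (<-≤-trans (subst (_< ∣ A ∣) (*-comm M p) big) bound))
      λ S S⊆B 0<S z → free S (↾-⊆ A _ ∘ S⊆B) 0<S (ZeroSum-quotient e k p∤ek s S z (zk S S⊆B z))
    where
    B = A ↾ OnHyperplane? (λ i → s i k) (quotient e k ∘ s) c
    zk : ∀ S → S ⊆ B → ZeroSum (quotient e k ∘ s) S → p∣ ∑ S (λ i → s i k)
    zk S S⊆B z = p∣-comb (+ 1) (ℤ.- + 1) (subst p∣_ (∑-+ S (λ i → s i k) (λ i → dot c (quotient e k (s i)))) (∣∑ S (λ i∈ → proj₂ (↾⁻ A (OnHyperplane? (λ i → s i k) (quotient e k ∘ s) c) (S⊆B i∈)))))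
        (p∣∑dot S c (quotient e k ∘ s) z) (lemma (∑ S (λ i → s i k)) _)
      where
      lemma : ∀ a b → a ≡ + 1 ℤ.* (a ℤ.+ b) ℤ.+ ℤ.- + 1 ℤ.* b
      lemma = solve-∀

  Zero-quotient : ∀ {d} (e : V (suc d)) k x → Zero (quotient e k x) → ∀ j → p∣ e k ℤ.* x j ℤ.+ ℤ.- e j ℤ.* x k
  Zero-quotient e k x z j with k Fin.≟ j
  ... | yes refl = p∣-scale 0ℤ p∣0 (lemma (e k) (x k))
    where
    lemma : ∀ a b → a ℤ.* b ℤ.+ ℤ.- a ℤ.* b ≡ 0ℤ ℤ.* 0ℤ
    lemma = solve-∀
  ... | no k≢j = subst (λ l → p∣ e k ℤ.* x l ℤ.+ ℤ.- e l ℤ.* x k) (Fin.punchIn-punchOut k≢j) (z (punchOut k≢j))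

  -- Each term lies on the line through (1, e) for only one of the p^d slopes e, namely u/x. The
  -- slope is fixed coordinate by coordinate, each time taking a value that few of the remaining
  -- terms have.
  missed-slope : ∀ {n} d (A : Subset n) (x : Fin n → ℤ) (u : Fin n → V d) → (∀ {i} → i ∈ A → p∤ x i) → ∣ A ∣ < p ^ d →
    ∃ λ (e : V d) → ∀ {i} → i ∈ A → ¬ (∀ j → p∣ u i j ℤ.- x i ℤ.* e j)
  missed-slope zero    A x u nz small = (λ ()) , λ i∈A → contradiction (0<∣∣ i∈A) (<⇒≱ small)
    where
    0<∣∣ : ∀ {n} {A : Subset n} {i} → i ∈ A → 0 < ∣ A ∣
    0<∣∣ here = s≤s z≤n
    0<∣∣ {A = inside ∷ A} (there h)  = s≤s z≤n
    0<∣∣ {A = outside ∷ A} (there h) = 0<∣∣ h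
  missed-slope (suc d) A x u nz small = extend (sparse-fibre p (p ^ d) A R? unique small)
    where
    R? : ∀ (c : Fin p) i → Dec (p∣ u i zero ℤ.- x i ℤ.* + toℕ c)
    R? c i = p∣? (u i zero ℤ.- x i ℤ.* + toℕ c)
    unique : ∀ {i} {c c′ : Fin p} → i ∈ A → p∣ u i zero ℤ.- x i ℤ.* + toℕ c → p∣ u i zero ℤ.- x i ℤ.* + toℕ c′ → c ≡ c′
    unique {i} {c} {c′} i∈A h h′ = residue-unique c c′ (cancel (nz i∈A)
      (p∣-comb (ℤ.- + 1) (+ 1) h h′ (lemma (u i zero) (x i) (+ toℕ c) (+ toℕ c′))))
      where
      lemma : ∀ u x c c′ → x ℤ.* (c ℤ.- c′) ≡ ℤ.- + 1 ℤ.* (u ℤ.- x ℤ.* c) ℤ.+ + 1 ℤ.* (u ℤ.- x ℤ.* c′)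
      lemma = solve-∀
    extend : (∃ λ c → ∣ A ↾ R? c ∣ < p ^ d) → ∃ λ (e : V (suc d)) → ∀ {i} → i ∈ A → ¬ (∀ j → p∣ u i j ℤ.- x i ℤ.* e j)
    extend (c , small′) with missed-slope d (A ↾ R? c) x (λ i → u i ∘ suc) (λ i∈ → nz (↾-⊆ A (R? c) i∈)) small′
    ... | e , missed = + toℕ c ∷ᵥ e , λ i∈A h → missed (↾⁺ A (R? c) i∈A (h zero)) (h ∘ suc)

  -- The number (p^d - 1)/(p - 1) of lines through the origin of F_p^d, sorted by the position of
  -- the first nonzero coordinate.
  lineCount : ℕ → ℕ
  lineCount zero    = 0
  lineCount (suc d) = p ^ d + lineCount d

  -- If fewer than p^d terms have a nonzero first coordinate, some slope is missed. Otherwise fewer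
  -- than `lineCount d` terms are left in the hyperplane of vanishing first coordinate, and the line
  -- is found there.
  missed-line : ∀ {n} d (A : Subset n) (x : Fin n → V d) → (∀ {i} → i ∈ A → ¬ Zero (x i)) → ∣ A ∣ < lineCount d →
    ∃ λ (e : V d) → ∃ λ k → e k ≡ + 1 × (∀ {i} → i ∈ A → ¬ (∀ j → p∣ x i j ℤ.- x i k ℤ.* e j))
  missed-line (suc d) A x nz small with ∣ A₁ ∣ <? p ^ d
    where
    A₁ = A ─ (A ↾ (λ i → p∣? x i zero))
  ... | yes h with missed-slope d _ (λ i → x i zero) (λ i → x i ∘ suc) (λ i∈ → proj₂ (─↾⁻ A (λ i → p∣? x i zero) i∈)) h
  ...   | e , missed = + 1 ∷ᵥ e , zero , refl , missed′
    where
    missed′ : ∀ {i} → i ∈ A → ¬ (∀ j → p∣ x i j ℤ.- x i zero ℤ.* (+ 1 ∷ᵥ e) j)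
    missed′ {i} i∈A z with p∣? x i zero
    ... | no h′  = missed (x∈p∧x∉q⇒x∈p─q i∈A (h′ ∘ proj₂ ∘ ↾⁻ A (λ i → p∣? x i zero))) (z ∘ suc)
    ... | yes h′ = nz i∈A λ { zero → h′ ; (suc j) → p∣-comb (+ 1) (e j) (z (suc j)) h′ (lemma (x i (suc j)) (x i zero) (e j)) }
      where
      lemma : ∀ a b e → a ≡ + 1 ℤ.* (a ℤ.- b ℤ.* e) ℤ.+ e ℤ.* b
      lemma = solve-∀
  missed-line (suc d) A x nz small | no h with missed-line d A₀ (λ i → x i ∘ suc) nz′ small′
    where
    A₀ = A ↾ (λ i → p∣? x i zero)
    nz′ : ∀ {i} → i ∈ A₀ → ¬ Zero (x i ∘ suc)
    nz′ i∈ z with ↾⁻ A (λ i → p∣? x i zero) i∈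
    ... | i∈A , h′ = nz i∈A λ { zero → h′ ; (suc j) → z j }
    small′ : ∣ A₀ ∣ < lineCount d
    small′ = +-cancelʳ-< (p ^ d) _ _ (≤-<-trans (+-monoʳ-≤ ∣ A₀ ∣ (≮⇒≥ h)) (subst₂ _<_ (∣∣-↾ A (λ i → p∣? x i zero)) (+-comm (p ^ d) (lineCount d)) small))
  ... | e , k , ek≡1 , missed = 0ℤ ∷ᵥ e , suc k , ek≡1 , missed′
    where
    missed′ : ∀ {i} → i ∈ A → ¬ (∀ j → p∣ x i j ℤ.- x i (suc k) ℤ.* (0ℤ ∷ᵥ e) j)
    missed′ {i} i∈A z = missed (↾⁺ A (λ i → p∣? x i zero) i∈A (subst p∣_ (lemma (x i zero) (x i (suc k))) (z zero))) (z ∘ suc)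
      where
      lemma : ∀ a b → a ℤ.- b ℤ.* 0ℤ ≡ a
      lemma = solve-∀

  Free-list : ∀ {n d Small} {s : Fin n → V d} {A} → Free Small s A → ∀ {l} → Unique l → All (_∈ A) l → 0 < length l →
    (∀ j → p∣ ∑ₗ l (λ i → s i j)) → ¬ Small (length l)
  Free-list {Small = Small} free {l} unique ∈A 0<l z small =
    free (fromList l) (fromList⁻ ∈A) (subst (0 <_) (sym (∣fromList∣ unique)) 0<l)
      (λ j → subst p∣_ (sym (∑-fromList unique _)) (z j)) (subst Small (sym (∣fromList∣ unique)) small)

  Free⇒nonzero : ∀ {n d Small} {s : Fin n → V d} {A} → Free Small s A → Small 1 → ∀ {i} → i ∈ A → ¬ Zero (s i)
  Free⇒nonzero {Small = Small} free small i∈A z =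
    Free-list {Small = Small} free ([] ∷ []) (i∈A ∷ []) (s≤s z≤n) (λ j → ∣m∣n⇒∣m+n (z j) p∣0) small

  grow : ∀ Small {d M} → Small 1 → suc (M * p) < lineCount (suc d) → Unavoidable Small d (suc M) → Unavoidable Small (suc d) (suc (M * p))
  grow Small {d} {M} small room unav = Unavoidable-exact Small λ {n} s A size free → contra s A size free
      (missed-line (suc d) A s (Free⇒nonzero {Small = Small} free small) (subst (_< lineCount (suc d)) (sym size) room))
    where
    contra : ∀ {n} (s : Fin n → V (suc d)) A → ∣ A ∣ ≡ suc (M * p) → Free Small s A →
      ¬ ∃ λ (e : V (suc d)) → ∃ λ k → e k ≡ + 1 × (∀ {i} → i ∈ A → ¬ (∀ j → p∣ s i j ℤ.- s i k ℤ.* e j))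
    contra s A size free (e , k , ek≡1 , missed) =
      step {Small} unav s A e k (λ h → p∤1 (subst p∣_ ek≡1 h))
        (λ {i} i∈A z → missed i∈A λ j → subst p∣_ (trans (cong (λ a → a ℤ.* s i j ℤ.+ ℤ.- e j ℤ.* s i k) ek≡1) (lemma (s i j) (e j) (s i k))) (Zero-quotient e k (s i) z j))
        (≤-reflexive (sym size)) free
      where
      lemma : ∀ a b c → + 1 ℤ.* a ℤ.+ ℤ.- b ℤ.* c ≡ a ℤ.- c ℤ.* b
      lemma = solve-∀

  lineCount-lower : ∀ {N} m → N ≤ p ^ (3 + m) + p ^ (2 + m) → suc N < lineCount (4 + m)
  lineCount-lower {N} m h = begin-strict
    suc N                                          ≤⟨ s≤s h ⟩
    suc (a + b)                                    <⟨ n<1+n _ ⟩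
    suc (suc (a + b))                              ≡⟨ +-comm 2 (a + b) ⟩
    -- The next two summands of `lineCount` are at least 1 each and absorb the two units lost to
    -- strictness.
    a + b + 2                                      ≤⟨ +-monoʳ-≤ (a + b) (+-mono-≤ (m^n>0 p (1 + m)) (m^n>0 p m)) ⟩
    a + b + (p ^ (1 + m) + p ^ m)                  ≤⟨ m≤m+n _ (lineCount m) ⟩
    a + b + (p ^ (1 + m) + p ^ m) + lineCount m    ≡⟨ lemma a b (p ^ (1 + m)) (p ^ m) (lineCount m) ⟩
    lineCount (4 + m)                              ∎
    where
    open ≤-Reasoning
    a b : ℕ
    a = p ^ (3 + m)
    b = p ^ (2 + m)
    lemma : ∀ a b c d e → a + b + (c + d) + e ≡ a + (b + (c + (d + e)))
    lemma = ℕ-solve-∀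

  M : ℕ
  M = 6 * q + 2

  iterate : ∀ Small {d} → (∀ e → Unavoidable Small (d + e) (suc (M * p ^ e)) → Unavoidable Small (suc (d + e)) (suc (M * p ^ e * p))) →
    Unavoidable Small d (suc M) → ∀ e → Unavoidable Small (e + d) (suc (M * p ^ e))
  iterate Small {d} next base e = subst (λ m → Unavoidable Small m (suc (M * p ^ e))) (+-comm d e) (go e)
    where
    go : ∀ e → Unavoidable Small (d + e) (suc (M * p ^ e))
    go zero    = subst₂ (Unavoidable Small) (sym (+-identityʳ d)) (cong suc (sym (*-identityʳ M))) base
    go (suc e) = subst₂ (Unavoidable Small) (sym (+-suc d e)) (cong suc (lemma M (p ^ e) p)) (next e (go e))
      where
      lemma : ∀ a b c → a * b * c ≡ a * (c * b)
      lemma = ℕ-solve-∀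

  room : ∀ a e → M ≤ p ^ suc a + p ^ a → M * p ^ e * p ≤ p ^ (2 + (a + e)) + p ^ (1 + (a + e))
  room a e h = begin
    M * p ^ e * p                                           ≤⟨ *-monoˡ-≤ p (*-monoˡ-≤ (p ^ e) h) ⟩
    (p * p ^ a + p ^ a) * p ^ e * p                         ≡⟨ lemma p (p ^ a) (p ^ e) ⟩
    p * (p * (p ^ a * p ^ e)) + p * (p ^ a * p ^ e)         ≡⟨ cong (λ x → p * (p * x) + p * x) (sym (^-distribˡ-+-* p a e)) ⟩
    p ^ (2 + (a + e)) + p ^ (1 + (a + e))                   ∎
    where
    open ≤-Reasoning
    lemma : ∀ p x y → (p * x + x) * y * p ≡ p * (p * (x * y)) + p * (x * y)
    lemma = ℕ-solve-∀

  -- The lines of F_p^4 outnumber the terms as soon as 6q + 2 ≤ p^2 + p. For p = 3 this reads 14 ≤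
  -- 12 and fails; it holds for every prime from 5 on.
  main₁ : 4 ≤ q → Unavoidable Small₁ 3 (suc M) → ∀ e → Unavoidable Small₁ (e + 3) (suc (M * p ^ e))
  main₁ 4≤q = iterate Small₁ λ e → grow Small₁ {3 + e} {M * p ^ e} small (lineCount-lower e (room 1 e bound))
    where
    small : Small₁ 1
    small = subst (2 ≤_) (lemma q) (m≤m+n 2 (3 * q))
      where
      lemma : ∀ q → 2 + 3 * q ≡ q + (suc q + (suc q + 0))
      lemma = ℕ-solve-∀
    bound : M ≤ p ^ 2 + p ^ 1
    bound = begin
      6 * q + 2                ≡⟨ lemma₁ q ⟩
      4 * q + (2 * q + 2)      ≤⟨ +-monoˡ-≤ _ (*-monoˡ-≤ q 4≤q) ⟩
      q * q + (2 * q + 2)      ≤⟨ m≤m+n _ q ⟩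
      q * q + (2 * q + 2) + q  ≡⟨ lemma₂ q ⟩
      p ^ 2 + p ^ 1            ∎
      where
      open ≤-Reasoning
      lemma₁ : ∀ q → 6 * q + 2 ≡ 4 * q + (2 * q + 2)
      lemma₁ = ℕ-solve-∀
      lemma₂ : ∀ q → q * q + (2 * q + 2) + q ≡ suc q * (suc q * 1) + suc q * 1
      lemma₂ = ℕ-solve-∀

  -- Starting one dimension higher weakens the requirement to 6q + 2 ≤ p^3 + p^2, which holds
  -- already for p = 2.
  main₂ : Unavoidable Small₂ 4 (suc M) → ∀ e → Unavoidable Small₂ (e + 4) (suc (M * p ^ e))
  main₂ = iterate Small₂ λ e → grow Small₂ {4 + e} {M * p ^ e} (≤-trans (<⇒≤ p>1) (m≤m+n p _)) (lineCount-lower (suc e) (room 2 e bound))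
    where
    1≤q : 1 ≤ q
    1≤q = ≤-pred p>1
    bound : M ≤ p ^ 3 + p ^ 2
    bound = begin
      6 * q + 2                                              ≡⟨ lemma₁ q ⟩
      1 * q + (5 * q + 2)                                    ≤⟨ +-monoˡ-≤ _ (*-monoˡ-≤ q 1≤q) ⟩
      q * q + (5 * q + 2)                                    ≤⟨ m≤m+n _ (q * q * q + 3 * (q * q)) ⟩
      q * q + (5 * q + 2) + (q * q * q + 3 * (q * q))        ≡⟨ lemma₂ q ⟩
      p ^ 3 + p ^ 2                                          ∎
      where
      open ≤-Reasoning
      lemma₁ : ∀ q → 6 * q + 2 ≡ 1 * q + (5 * q + 2)
      lemma₁ = ℕ-solve-∀
      lemma₂ : ∀ q → q * q + (5 * q + 2) + (q * q * q + 3 * (q * q)) ≡ suc q * (suc q * (suc q * 1)) + suc q * (suc q * 1)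
      lemma₂ = ℕ-solve-∀

  Collision : ∀ {n d} → (Fin n → V d) → Subset n → Set
  Collision x B = ∀ {i i′} → i ∈ B → i′ ∈ B → ∀ j → p∣ x i j ℤ.- x i′ j

  collide : ∀ {n} d t (A : Subset n) (x : Fin n → V d) → p ^ d * t < ∣ A ∣ → ∃ λ B → B ⊆ A × t < ∣ B ∣ × Collision x B
  collide zero    t A x big = A , id , subst (_< ∣ A ∣) (*-identityˡ t) big , λ _ _ ()
  collide (suc d) t A x big = extend (pigeonhole p (p ^ d * t) A R? (λ {i} _ → residue (x i zero)) (subst (_< ∣ A ∣) (*-assoc p (p ^ d) t) big))
    where
    R? : ∀ (c : Fin p) i → Dec (p∣ x i zero ℤ.- + toℕ c)
    R? c i = p∣? (x i zero ℤ.- + toℕ c)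
    extend : (∃ λ c → p ^ d * t < ∣ A ↾ R? c ∣) → ∃ λ B → B ⊆ A × t < ∣ B ∣ × Collision x B
    extend (c , big′) with collide d t (A ↾ R? c) (λ i → x i ∘ suc) big′
    ... | B , B⊆ , t<B , coll = B , ↾-⊆ A (R? c) ∘ B⊆ , t<B , coll′
      where
      coll′ : Collision x B
      coll′ i∈ i′∈ (suc j) = coll i∈ i′∈ j
      coll′ {i} {i′} i∈ i′∈ zero =
        p∣-comb (+ 1) (ℤ.- + 1) (proj₂ (↾⁻ A (R? c) (B⊆ i∈))) (proj₂ (↾⁻ A (R? c) (B⊆ i′∈))) (lemma (x i zero) (x i′ zero) (+ toℕ c))
        where
        lemma : ∀ a b c → a ℤ.- b ≡ + 1 ℤ.* (a ℤ.- c) ℤ.+ ℤ.- + 1 ℤ.* (b ℤ.- c)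
        lemma = solve-∀

  quotient-cong : ∀ {d} (e : V (suc d)) k {x y : V (suc d)} → (∀ j → x j ≡ y j) → ∀ j → quotient e k x j ≡ quotient e k y j
  quotient-cong e k x≗y j = cong₂ (λ u v → e k ℤ.* u ℤ.+ ℤ.- e (punchIn k j) ℤ.* v) (x≗y (punchIn k j)) (x≗y k)

  quotient-linear : ∀ {d} (e : V (suc d)) k (x y : V (suc d)) c j →
    quotient e k (λ j → x j ℤ.+ c ℤ.* y j) j ≡ quotient e k x j ℤ.+ c ℤ.* quotient e k y j
  quotient-linear e k x y c j = lemma (e k) (e (punchIn k j)) (x (punchIn k j)) (y (punchIn k j)) (x k) (y k) c
    where
    lemma : ∀ a b x y u v c → a ℤ.* (x ℤ.+ c ℤ.* y) ℤ.+ ℤ.- b ℤ.* (u ℤ.+ c ℤ.* v) ≡ (a ℤ.* x ℤ.+ ℤ.- b ℤ.* u) ℤ.+ c ℤ.* (a ℤ.* y ℤ.+ ℤ.- b ℤ.* v)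
    lemma = solve-∀

  quotient-∑ₗ : ∀ {n d} (e : V (suc d)) k (s : Fin n → V (suc d)) l j →
    quotient e k (λ j → ∑ₗ l (λ i → s i j)) j ≡ ∑ₗ l (λ i → quotient e k (s i) j)
  quotient-∑ₗ e k s l j = sym (∑ₗ-lincomb l (e k) (ℤ.- e (punchIn k j)) (λ i → s i (punchIn k j)) (λ i → s i k))

  opaque
    -- The coefficient is returned as a residue because it will serve as a number of copies: how
    -- many doubled terms complete a given sum to zero.
    quotient-kernel : ∀ {d} (e : V (suc d)) k x → p∤ e k → Zero (quotient e k x) →
      ∃ λ (c : Fin p) → Zero (λ j → x j ℤ.+ + toℕ c ℤ.* e j)
    quotient-kernel e k x p∤ek z with solve-linear (x k) (e k) p∤ek
    ... | c , h = c , λ j → cancel p∤ek (p∣-comb (+ 1) (e j) (Zero-quotient e k x z j) h (lemma (e k) (e j) (x j) (x k) (+ toℕ c)))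
      where
      lemma : ∀ a b x u c → a ℤ.* (x ℤ.+ c ℤ.* b) ≡ + 1 ℤ.* (a ℤ.* x ℤ.+ ℤ.- b ℤ.* u) ℤ.+ b ℤ.* (u ℤ.+ c ℤ.* a)
      lemma = solve-∀

    ¬Zero⇒∃ : ∀ {d} (v : V d) → ¬ Zero v → ∃ λ k → p∤ v k
    ¬Zero⇒∃ v = Fin.¬∀⟶∃¬ _ (λ k → p∣ v k) (λ k → p∣? v k)

-- The prime 2

module ModTwo (pr : Prime 2) where
  open ModPrime 1 pr

  -- The 8 · 2^e + 1 terms outnumber the 2^(e+3) vectors of the space by one.
  main₁-2 : ∀ e → Unavoidable Small₁ (e + 3) (suc (8 * 2 ^ e))
  main₁-2 e s A big free = contra (collide (e + 3) 1 A s (subst (_< ∣ A ∣) eq big))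
    where
    eq : 8 * 2 ^ e ≡ 2 ^ (e + 3) * 1
    eq = trans (*-comm 8 (2 ^ e)) (trans (sym (^-distribˡ-+-* 2 e 3)) (sym (*-identityʳ _)))
    contra : ¬ ∃ λ B → B ⊆ A × 1 < ∣ B ∣ × Collision s B
    contra (B , B⊆A , 1<B , coll) with enumerate 2 B 1<B
    ... | f , f∈B , f-inj =
      Free-list {Small = Small₁} free (((λ eq → Fin.0≢1+n (f-inj eq)) ∷ []) ∷ [] ∷ []) (B⊆A (f∈B i) ∷ B⊆A (f∈B i′) ∷ []) (s≤s z≤n)
        (λ j → p∣-comb (+ 1) (s (f i′) j) (coll (f∈B i) (f∈B i′) j) p∣p (lemma (s (f i) j) (s (f i′) j))) (s≤s (s≤s (s≤s (s≤s z≤n))))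
      where
      i i′ : Fin 2
      i  = zero
      i′ = suc zero
      lemma : ∀ a b → a ℤ.+ (b ℤ.+ 0ℤ) ≡ + 1 ℤ.* (a ℤ.- b) ℤ.+ b ℤ.* + 2
      lemma = solve-∀

-- The prime 3

Σ₄≤9 : (f : Fin 4 → ℕ) → (∀ c → f c ≤ 3) → ∀ k → f k ≤ 0 → Σℕ 4 f ≤ 9
Σ₄≤9 f f≤3 k fk≤0 = ≤-trans (Σℕ-mono 4 f≤cap) (total k)
  where
  cap : Fin 4 → Fin 4 → ℕ
  cap k c = if does (c Fin.≟ k) then 0 else 3
  f≤cap : ∀ c → f c ≤ cap k c
  f≤cap c with c Fin.≟ k
  ... | yes refl = fk≤0
  ... | no _     = f≤3 c
  total : ∀ k → Σℕ 4 (cap k) ≤ 9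
  total = toWitness {a? = Fin.all? (λ k → Σℕ 4 (cap k) ≤? 9)} _

Σ₄≤10 : (f : Fin 4 → ℕ) → (∀ c → f c ≤ 3) → ∀ k l → k ≢ l → f k ≤ 2 → f l ≤ 2 → Σℕ 4 f ≤ 10
Σ₄≤10 f f≤3 k l k≢l fk≤2 fl≤2 = ≤-trans (Σℕ-mono 4 f≤cap) ([ (λ k≡l → contradiction k≡l k≢l) , id ]′ (total k l))
  where
  cap : Fin 4 → Fin 4 → Fin 4 → ℕ
  cap k l c = if does (c Fin.≟ k) then 2 else if does (c Fin.≟ l) then 2 else 3
  f≤cap : ∀ c → f c ≤ cap k l c
  f≤cap c with c Fin.≟ k | c Fin.≟ l
  ... | yes refl | _        = fk≤2
  ... | no _     | yes refl = fl≤2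
  ... | no _     | no _     = f≤3 c
  total : ∀ k l → k ≡ l ⊎ Σℕ 4 (cap k l) ≤ 10
  total = toWitness {a? = Fin.all? (λ k → Fin.all? (λ l → (k Fin.≟ l) ⊎-dec (Σℕ 4 (cap k l) ≤? 10)))} _

<?-asym : ∀ {n} {a b : Fin n} → a ≢ b → does (a Fin.<? b) ≢ does (b Fin.<? a)
<?-asym {a = a} {b} a≢b eq with Fin.<-cmp a b
... | tri< a<b _ b≮a = contradiction (trans (sym (dec-true (a Fin.<? b) a<b)) (trans eq (dec-false (b Fin.<? a) b≮a))) λ ()
... | tri≈ _ a≡b _   = a≢b a≡b
... | tri> a≮b _ b<a = contradiction (trans (sym (dec-false (a Fin.<? b) a≮b)) (trans eq (dec-true (b Fin.<? a) b<a))) λ ()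

module ModThree (pr : Prime 3) where
  open ModPrime 2 pr

  same-or-opposite : ∀ {a b} → p∤ a → p∤ b → p∣ a ℤ.- b ⊎ p∣ a ℤ.+ b
  same-or-opposite {a} {b} p∤a p∤b with residue a | residue b
  ... | 0F , h | _      = contradiction (subst p∣_ (ℤ.+-identityʳ a) h) p∤a
  ... | _      | 0F , h = contradiction (subst p∣_ (ℤ.+-identityʳ b) h) p∤b
  ... | 1F , h | 1F , k = inj₁ (subst p∣_ (lemma a b) (∣m∣n⇒∣m-n h k))
    where
    lemma : ∀ a b → (a ℤ.- + 1) ℤ.- (b ℤ.- + 1) ≡ a ℤ.- b
    lemma = solve-∀
  ... | 2F , h | 2F , k = inj₁ (subst p∣_ (lemma a b) (∣m∣n⇒∣m-n h k))
    where
    lemma : ∀ a b → (a ℤ.- + 2) ℤ.- (b ℤ.- + 2) ≡ a ℤ.- b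
    lemma = solve-∀
  ... | 1F , h | 2F , k = inj₂ (subst p∣_ (lemma a b) (∣m∣n⇒∣m+n (∣m∣n⇒∣m+n h k) p∣p))
    where
    lemma : ∀ a b → (a ℤ.- + 1) ℤ.+ (b ℤ.- + 2) ℤ.+ + 3 ≡ a ℤ.+ b
    lemma = solve-∀
  ... | 2F , h | 1F , k = inj₂ (subst p∣_ (lemma a b) (∣m∣n⇒∣m+n (∣m∣n⇒∣m+n h k) p∣p))
    where
    lemma : ∀ a b → (a ℤ.- + 2) ℤ.+ (b ℤ.- + 1) ℤ.+ + 3 ≡ a ℤ.+ b
    lemma = solve-∀

  -- The four lines through the origin of F₃².
  OnLine : Fin 4 → ℤ → ℤ → Set
  OnLine 0F a b = p∣ b
  OnLine 1F a b = p∣ a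
  OnLine 2F a b = p∣ a ℤ.- b
  OnLine 3F a b = p∣ a ℤ.+ b

  OnLine? : ∀ k a b → Dec (OnLine k a b)
  OnLine? 0F a b = p∣? b
  OnLine? 1F a b = p∣? a
  OnLine? 2F a b = p∣? (a ℤ.- b)
  OnLine? 3F a b = p∣? (a ℤ.+ b)

  some-line : ∀ a b → ∃ λ k → OnLine k a b
  some-line a b with p∣? a | p∣? b
  ... | yes h | _     = 1F , h
  ... | no _  | yes h = 0F , h
  ... | no h  | no k  = [ 2F ,_ , 3F ,_ ]′ (same-or-opposite h k)

  Null : ℤ → ℤ → Set
  Null a b = p∣ a × p∣ b

  lines-meet : ∀ k l {a b} → k ≢ l → OnLine k a b → OnLine l a b → Null a b
  lines-meet 0F 0F k≢l h k = contradiction refl k≢l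
  lines-meet 1F 1F k≢l h k = contradiction refl k≢l
  lines-meet 2F 2F k≢l h k = contradiction refl k≢l
  lines-meet 3F 3F k≢l h k = contradiction refl k≢l
  lines-meet 0F 1F k≢l h k = k , h
  lines-meet 1F 0F k≢l h k = h , k
  lines-meet 0F 2F {a} {b} k≢l h k = p∣-comb (+ 1) (+ 1) h k (lemma a b) , h
    where
    lemma : ∀ a b → a ≡ + 1 ℤ.* b ℤ.+ + 1 ℤ.* (a ℤ.- b)
    lemma = solve-∀
  lines-meet 0F 3F {a} {b} k≢l h k = p∣-comb (ℤ.- + 1) (+ 1) h k (lemma a b) , h
    where
    lemma : ∀ a b → a ≡ ℤ.- + 1 ℤ.* b ℤ.+ + 1 ℤ.* (a ℤ.+ b)
    lemma = solve-∀
  lines-meet 1F 2F {a} {b} k≢l h k = h , p∣-comb (+ 1) (ℤ.- + 1) h k (lemma a b)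
    where
    lemma : ∀ a b → b ≡ + 1 ℤ.* a ℤ.+ ℤ.- + 1 ℤ.* (a ℤ.- b)
    lemma = solve-∀
  lines-meet 1F 3F {a} {b} k≢l h k = h , p∣-comb (ℤ.- + 1) (+ 1) h k (lemma a b)
    where
    lemma : ∀ a b → b ≡ ℤ.- + 1 ℤ.* a ℤ.+ + 1 ℤ.* (a ℤ.+ b)
    lemma = solve-∀
  lines-meet 2F 3F {a} {b} k≢l h k =
    cancel {+ 2} (p∤small (s≤s z≤n) ≤-refl) (p∣-comb (+ 1) (+ 1) h k (lemma₁ a b)) ,
    cancel {+ 2} (p∤small (s≤s z≤n) ≤-refl) (p∣-comb (ℤ.- + 1) (+ 1) h k (lemma₂ a b))
    where
    lemma₁ : ∀ a b → + 2 ℤ.* a ≡ + 1 ℤ.* (a ℤ.- b) ℤ.+ + 1 ℤ.* (a ℤ.+ b)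
    lemma₁ = solve-∀
    lemma₂ : ∀ a b → + 2 ℤ.* b ≡ ℤ.- + 1 ℤ.* (a ℤ.- b) ℤ.+ + 1 ℤ.* (a ℤ.+ b)
    lemma₂ = solve-∀
  lines-meet 2F 0F k≢l h k = lines-meet 0F 2F (λ ()) k h
  lines-meet 3F 0F k≢l h k = lines-meet 0F 3F (λ ()) k h
  lines-meet 2F 1F k≢l h k = lines-meet 1F 2F (λ ()) k h
  lines-meet 3F 1F k≢l h k = lines-meet 1F 3F (λ ()) k h
  lines-meet 3F 2F k≢l h k = lines-meet 2F 3F (λ ()) k h

  same-line : ∀ k {a b c d} → OnLine k a b → OnLine k c d → ¬ Null a b → ¬ Null c d →
    Null (a ℤ.- c) (b ℤ.- d) ⊎ Null (a ℤ.+ c) (b ℤ.+ d)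
  same-line 0F h k n m with same-or-opposite (λ z → n (z , h)) (λ z → m (z , k))
  ... | inj₁ z = inj₁ (z , ∣m∣n⇒∣m-n h k)
  ... | inj₂ z = inj₂ (z , ∣m∣n⇒∣m+n h k)
  same-line 1F h k n m with same-or-opposite (λ z → n (h , z)) (λ z → m (k , z))
  ... | inj₁ z = inj₁ (∣m∣n⇒∣m-n h k , z)
  ... | inj₂ z = inj₂ (∣m∣n⇒∣m+n h k , z)
  same-line 2F {a} {b} {c} {d} h k n m with same-or-opposite (λ z → n (lines-meet 1F 2F (λ ()) z h)) (λ z → m (lines-meet 1F 2F (λ ()) z k))
  ... | inj₁ z = inj₁ (z , subst p∣_ (lemma a b c d) (∣m∣n⇒∣m-n z (∣m∣n⇒∣m-n h k)))
    where
    lemma : ∀ a b c d → (a ℤ.- c) ℤ.- ((a ℤ.- b) ℤ.- (c ℤ.- d)) ≡ b ℤ.- d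
    lemma = solve-∀
  ... | inj₂ z = inj₂ (z , subst p∣_ (lemma a b c d) (∣m∣n⇒∣m-n z (∣m∣n⇒∣m+n h k)))
    where
    lemma : ∀ a b c d → (a ℤ.+ c) ℤ.- ((a ℤ.- b) ℤ.+ (c ℤ.- d)) ≡ b ℤ.+ d
    lemma = solve-∀
  same-line 3F {a} {b} {c} {d} h k n m with same-or-opposite (λ z → n (lines-meet 1F 3F (λ ()) z h)) (λ z → m (lines-meet 1F 3F (λ ()) z k))
  ... | inj₁ z = inj₁ (z , subst p∣_ (lemma a b c d) (∣m∣n⇒∣m-n (∣m∣n⇒∣m-n h k) z))
    where
    lemma : ∀ a b c d → ((a ℤ.+ b) ℤ.- (c ℤ.+ d)) ℤ.- (a ℤ.- c) ≡ b ℤ.- d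
    lemma = solve-∀
  ... | inj₂ z = inj₂ (z , subst p∣_ (lemma a b c d) (∣m∣n⇒∣m-n (∣m∣n⇒∣m+n h k) z))
    where
    lemma : ∀ a b c d → ((a ℤ.+ b) ℤ.+ (c ℤ.+ d)) ℤ.- (a ℤ.+ c) ≡ b ℤ.+ d
    lemma = solve-∀

  NullTriple : (a b : Fin 4 → ℤ) → Fin 4 → Fin 4 → Fin 4 → Set
  NullTriple a b k l m = Null (a k ℤ.+ (a l ℤ.+ (a m ℤ.+ 0ℤ))) (b k ℤ.+ (b l ℤ.+ (b m ℤ.+ 0ℤ)))

  -- Up to sign, a point of line 2 is the sum, and a point of line 3 the difference, of points of lines 0 and 1.
  four-lines : (a b : Fin 4 → ℤ) → (∀ k → OnLine k (a k) (b k)) → (∀ k → ¬ Null (a k) (b k)) →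
    ∃ λ k → ∃ λ l → ∃ λ m → k ≢ l × k ≢ m × l ≢ m × NullTriple a b k l m
  four-lines a b on nn = cases (same-or-opposite p∤α p∤γ) (same-or-opposite p∤β p∤γ) (same-or-opposite p∤δ p∤γ)
    where
    α β γ δ a₁ b₀ c₁ d₁ : ℤ
    α = a 0F
    β = b 1F
    γ = a 2F
    δ = a 3F
    a₁ = b 0F
    b₀ = a 1F
    c₁ = b 2F
    d₁ = b 3F
    p∤α : p∤ α
    p∤α z = nn 0F (z , on 0F)
    p∤β : p∤ β
    p∤β z = nn 1F (on 1F , z)
    p∤γ : p∤ γ
    p∤γ z = nn 2F (lines-meet 1F 2F (λ ()) z (on 2F))
    p∤δ : p∤ δ
    p∤δ z = nn 3F (lines-meet 1F 3F (λ ()) z (on 3F))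

    eq₀₁ : ∀ x y z → (x ℤ.+ z) ℤ.+ y ≡ x ℤ.+ (y ℤ.+ (z ℤ.+ 0ℤ))
    eq₀₁ = solve-∀

    Result = ∃ λ k → ∃ λ l → ∃ λ m → k ≢ l × k ≢ m × l ≢ m × NullTriple a b k l m

    012F : p∣ α ℤ.+ γ → p∣ β ℤ.+ γ → Result
    012F h k = 0F , 1F , 2F , (λ ()) , (λ ()) , (λ ()) ,
      subst p∣_ (eq₀₁ α b₀ γ) (∣m∣n⇒∣m+n h (on 1F)) ,
      subst p∣_ (lemma a₁ β γ c₁) (∣m∣n⇒∣m-n (∣m∣n⇒∣m+n (on 0F) k) (on 2F))
      where
      lemma : ∀ a b c d → (a ℤ.+ (b ℤ.+ c)) ℤ.- (c ℤ.- d) ≡ a ℤ.+ (b ℤ.+ (d ℤ.+ 0ℤ))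
      lemma = solve-∀

    013F : p∣ α ℤ.+ δ → p∣ β ℤ.- δ → Result
    013F h k = 0F , 1F , 3F , (λ ()) , (λ ()) , (λ ()) ,
      subst p∣_ (eq₀₁ α b₀ δ) (∣m∣n⇒∣m+n h (on 1F)) ,
      subst p∣_ (lemma a₁ β δ d₁) (∣m∣n⇒∣m+n (∣m∣n⇒∣m+n (on 0F) k) (on 3F))
      where
      lemma : ∀ a b c d → (a ℤ.+ (b ℤ.- c)) ℤ.+ (c ℤ.+ d) ≡ a ℤ.+ (b ℤ.+ (d ℤ.+ 0ℤ))
      lemma = solve-∀

    023F : p∣ α ℤ.- γ → p∣ δ ℤ.- γ → Result
    023F h k = 0F , 2F , 3F , (λ ()) , (λ ()) , (λ ()) ,
      p∣-comb (+ 1) γ (∣m∣n⇒∣m+n h k) p∣p (lemma₁ α γ δ) ,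
      subst p∣_ (lemma₂ a₁ c₁ d₁ γ δ) (∣m∣n⇒∣m-n (∣m∣n⇒∣m+n (∣m∣n⇒∣m-n (on 0F) (on 2F)) (on 3F)) k)
      where
      lemma₁ : ∀ a c d → a ℤ.+ (c ℤ.+ (d ℤ.+ 0ℤ)) ≡ + 1 ℤ.* ((a ℤ.- c) ℤ.+ (d ℤ.- c)) ℤ.+ c ℤ.* + 3
      lemma₁ = solve-∀
      lemma₂ : ∀ a₁ c₁ d₁ c d → (a₁ ℤ.- (c ℤ.- c₁)) ℤ.+ (d ℤ.+ d₁) ℤ.- (d ℤ.- c) ≡ a₁ ℤ.+ (c₁ ℤ.+ (d₁ ℤ.+ 0ℤ))
      lemma₂ = solve-∀

    123F : p∣ δ ℤ.+ γ → p∣ β ℤ.- γ → Result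
    123F h k = 1F , 2F , 3F , (λ ()) , (λ ()) , (λ ()) ,
      subst p∣_ (lemma₁ b₀ γ δ) (∣m∣n⇒∣m+n (on 1F) h) ,
      p∣-comb (+ 1) γ (∣m∣n⇒∣m-n (∣m∣n⇒∣m+n (∣m∣n⇒∣m-n k (on 2F)) (on 3F)) h) p∣p (lemma₂ β c₁ d₁ γ δ)
      where
      lemma₁ : ∀ b c d → b ℤ.+ (d ℤ.+ c) ≡ b ℤ.+ (c ℤ.+ (d ℤ.+ 0ℤ))
      lemma₁ = solve-∀
      lemma₂ : ∀ b c₁ d₁ c d → b ℤ.+ (c₁ ℤ.+ (d₁ ℤ.+ 0ℤ)) ≡
        + 1 ℤ.* (((b ℤ.- c) ℤ.- (c ℤ.- c₁)) ℤ.+ (d ℤ.+ d₁) ℤ.- (d ℤ.+ c)) ℤ.+ c ℤ.* + 3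
      lemma₂ = solve-∀

    eq+ : ∀ a c d → (a ℤ.- c) ℤ.+ (d ℤ.+ c) ≡ a ℤ.+ d
    eq+ = solve-∀
    eq+′ : ∀ a c d → (a ℤ.+ c) ℤ.+ (d ℤ.- c) ≡ a ℤ.+ d
    eq+′ = solve-∀
    eq- : ∀ a c d → (a ℤ.+ c) ℤ.- (d ℤ.+ c) ≡ a ℤ.- d
    eq- = solve-∀
    eq-′ : ∀ a c d → (a ℤ.- c) ℤ.- (d ℤ.- c) ≡ a ℤ.- d
    eq-′ = solve-∀

    cases : p∣ α ℤ.- γ ⊎ p∣ α ℤ.+ γ → p∣ β ℤ.- γ ⊎ p∣ β ℤ.+ γ → p∣ δ ℤ.- γ ⊎ p∣ δ ℤ.+ γ → Result
    cases (inj₂ h) (inj₂ k) _        = 012F h k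
    cases (inj₁ h) _        (inj₁ l) = 023F h l
    cases (inj₁ h) (inj₁ k) (inj₂ l) = 123F l k
    cases (inj₁ h) (inj₂ k) (inj₂ l) = 013F (subst p∣_ (eq+ α γ δ) (∣m∣n⇒∣m+n h l)) (subst p∣_ (eq- β γ δ) (∣m∣n⇒∣m-n k l))
    cases (inj₂ h) (inj₁ k) (inj₁ l) = 013F (subst p∣_ (eq+′ α γ δ) (∣m∣n⇒∣m+n h l)) (subst p∣_ (eq-′ β γ δ) (∣m∣n⇒∣m-n k l))
    cases (inj₂ h) (inj₁ k) (inj₂ l) = 123F l k

  direction : ∀ {d} → ℤ → ℤ → V (2 + d)
  direction a b = a ∷ᵥ b ∷ᵥ (λ _ → 0ℤ)

  -- Only the plane of the first two coordinates is inspected, so no comparison of the numbers of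
  -- terms and lines enters. Three terms are short, as (3p - 1)/2 = 4.
  next₁ : ∀ d {N} → Unavoidable Small₁ (suc d) (suc N) → Unavoidable Small₁ (2 + d) (suc (N * p))
  next₁ d {N} unav s A big free = contra (four-lines (λ k → s (i k) 0F) (λ k → s (i k) 1F) on nn)
    where
    Hit : Fin 4 → Fin _ → Set
    Hit k i = i ∈ A × OnLine k (s i 0F) (s i 1F) × (∀ j → p∣ s i (suc (suc j)))

    find : ∀ (e : V (2 + d)) k → p∤ e k → ∃ λ i → i ∈ A × Zero (quotient e k (s i))
    find e k p∤ek with Fin.any? (λ i → (i ∈? A) ×-dec Zero? (quotient e k (s i)))
    ... | yes h = h
    ... | no h  = ⊥-elim (step {Small₁} {M = N} unav s A e k p∤ek (λ {i} i∈A z → h (i , i∈A , z)) big free)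

    rest : ∀ {a b} k i → p∤ direction {d} a b k → Zero (quotient (direction a b) k (s i)) → ∀ j → p∣ s i (suc (suc j))
    rest {a} {b} k i p∤e z j = cancel p∤e (subst p∣_ (lemma (direction {d} a b k) (s i (suc (suc j))) (s i k)) (Zero-quotient (direction a b) k (s i) z (suc (suc j))))
      where
      lemma : ∀ e x y → e ℤ.* x ℤ.+ ℤ.- 0ℤ ℤ.* y ≡ e ℤ.* x
      lemma = solve-∀

    hit : ∀ k → ∃ (Hit k)
    hit 0F with find (direction (+ 1) 0ℤ) 0F p∤1
    ... | i , i∈A , z = i , i∈A , subst p∣_ (lemma (s i 0F) (s i 1F)) (Zero-quotient (direction (+ 1) 0ℤ) 0F (s i) z 1F) , rest 0F i p∤1 z
      where
      lemma : ∀ x y → + 1 ℤ.* y ℤ.+ ℤ.- 0ℤ ℤ.* x ≡ y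
      lemma = solve-∀
    hit 1F with find (direction 0ℤ (+ 1)) 1F p∤1
    ... | i , i∈A , z = i , i∈A , subst p∣_ (lemma (s i 0F) (s i 1F)) (Zero-quotient (direction 0ℤ (+ 1)) 1F (s i) z 0F) , rest 1F i p∤1 z
      where
      lemma : ∀ x y → + 1 ℤ.* x ℤ.+ ℤ.- 0ℤ ℤ.* y ≡ x
      lemma = solve-∀
    hit 2F with find (direction (+ 1) (+ 1)) 0F p∤1
    ... | i , i∈A , z = i , i∈A , p∣-scale (ℤ.- + 1) (Zero-quotient (direction (+ 1) (+ 1)) 0F (s i) z 1F) (lemma (s i 0F) (s i 1F)) , rest 0F i p∤1 z
      where
      lemma : ∀ x y → x ℤ.- y ≡ ℤ.- + 1 ℤ.* (+ 1 ℤ.* y ℤ.+ ℤ.- + 1 ℤ.* x)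
      lemma = solve-∀
    hit 3F with find (direction (+ 1) (ℤ.- + 1)) 0F p∤1
    ... | i , i∈A , z = i , i∈A , subst p∣_ (lemma (s i 0F) (s i 1F)) (Zero-quotient (direction (+ 1) (ℤ.- + 1)) 0F (s i) z 1F) , rest 0F i p∤1 z
      where
      lemma : ∀ x y → + 1 ℤ.* y ℤ.+ ℤ.- (ℤ.- + 1) ℤ.* x ≡ x ℤ.+ y
      lemma = solve-∀

    i : Fin 4 → Fin _
    i k = proj₁ (hit k)
    i∈A : ∀ k → i k ∈ A
    i∈A k = proj₁ (proj₂ (hit k))
    on : ∀ k → OnLine k (s (i k) 0F) (s (i k) 1F)
    on k = proj₁ (proj₂ (proj₂ (hit k)))
    zeros : ∀ k j → p∣ s (i k) (suc (suc j))
    zeros k = proj₂ (proj₂ (proj₂ (hit k)))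
    nn : ∀ k → ¬ Null (s (i k) 0F) (s (i k) 1F)
    nn k (z , z′) = Free⇒nonzero {Small = Small₁} free (s≤s (s≤s z≤n)) (i∈A k) λ { 0F → z ; 1F → z′ ; (suc (suc j)) → zeros k j }
    i-inj : ∀ {k l} → k ≢ l → i k ≢ i l
    i-inj {k} {l} k≢l eq = nn k (lines-meet k l k≢l (on k) (subst (λ t → OnLine l (s t 0F) (s t 1F)) (sym eq) (on l)))

    contra : ¬ ∃ λ k → ∃ λ l → ∃ λ m → k ≢ l × k ≢ m × l ≢ m × NullTriple (λ k → s (i k) 0F) (λ k → s (i k) 1F) k l m
    contra (k , l , m , k≢l , k≢m , l≢m , z , z′) =
      Free-list {Small = Small₁} free ((i-inj k≢l ∷ i-inj k≢m ∷ []) ∷ (i-inj l≢m ∷ []) ∷ [] ∷ []) (i∈A k ∷ i∈A l ∷ i∈A m ∷ []) (s≤s z≤n)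
        (λ { 0F → z ; 1F → z′ ; (suc (suc j)) → ∣m∣n⇒∣m+n (zeros k j) (∣m∣n⇒∣m+n (zeros l j) (∣m∣n⇒∣m+n (zeros m j) p∣0)) })
        (≤ᵇ⇒≤ 6 8 _)

  -- Fifteen vectors in F₃⁴

  Equal : ∀ {n d} → (Fin n → V d) → Fin n → Fin n → Set
  Equal s i i′ = ∀ j → p∣ s i j ℤ.- s i′ j

  module Distinct {n} (s : Fin n → V 4) (A : Subset n) (free : Free Small₂ s A)
                  (distinct : ∀ {i i′} → i ∈ A → i′ ∈ A → i ≢ i′ → ¬ Equal s i i′) where

    SameSum OppositeSum : Fin n → Fin n → Fin n → Fin n → Set
    SameSum     a b c d = ∀ j → p∣ (s a j ℤ.+ s b j) ℤ.- (s c j ℤ.+ s d j)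
    OppositeSum a b c d = ∀ j → p∣ (s a j ℤ.+ s b j) ℤ.+ (s c j ℤ.+ s d j)

    free-list : ∀ {l} → Unique l → All (_∈ A) l → 0 < length l → length l ≤ 6 → ¬ (∀ j → p∣ ∑ₗ l (λ i → s i j))
    free-list unique ∈A 0<l l≤6 z = Free-list {Small = Small₂} free unique ∈A 0<l z l≤6

    no-opposite-disjoint : ∀ {a b c d} → a ∈ A → b ∈ A → c ∈ A → d ∈ A →
      a ≢ b → a ≢ c → a ≢ d → b ≢ c → b ≢ d → c ≢ d → ¬ OppositeSum a b c d
    no-opposite-disjoint {a} {b} {c} {d} a∈ b∈ c∈ d∈ ab ac ad bc bd cd h =
      free-list ((ab ∷ ac ∷ ad ∷ []) ∷ (bc ∷ bd ∷ []) ∷ (cd ∷ []) ∷ [] ∷ []) (a∈ ∷ b∈ ∷ c∈ ∷ d∈ ∷ []) (s≤s z≤n) (≤ᵇ⇒≤ 4 6 _)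
        λ j → subst p∣_ (lemma (s a j) (s b j) (s c j) (s d j)) (h j)
      where
      lemma : ∀ a b c d → (a ℤ.+ b) ℤ.+ (c ℤ.+ d) ≡ a ℤ.+ (b ℤ.+ (c ℤ.+ (d ℤ.+ 0ℤ)))
      lemma = solve-∀

    share : ∀ {a b d} → b ∈ A → d ∈ A → SameSum a b a d → b ≡ d
    share {a} {b} {d} b∈ d∈ h with b Fin.≟ d
    ... | yes eq = eq
    ... | no b≢d = contradiction (λ j → subst p∣_ (lemma (s a j) (s b j) (s d j)) (h j)) (distinct b∈ d∈ b≢d)
      where
      lemma : ∀ a b d → (a ℤ.+ b) ℤ.- (a ℤ.+ d) ≡ b ℤ.- d
      lemma = solve-∀

    swapʳ : ∀ {a b c d} → SameSum a b c d → SameSum a b d c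
    swapʳ {a} {b} {c} {d} h j = subst p∣_ (cong (λ t → (s a j ℤ.+ s b j) ℤ.- t) (ℤ.+-comm (s c j) (s d j))) (h j)

    swapˡ : ∀ {a b c d} → SameSum a b c d → SameSum b a c d
    swapˡ {a} {b} {c} {d} h j = subst p∣_ (cong (λ t → t ℤ.- (s c j ℤ.+ s d j)) (ℤ.+-comm (s a j) (s b j))) (h j)

    -- Modulo 3, adding a + b + (a + c) = 0 and c + d + (a + c) = 0 gives b + d = 0.
    opposite-core : ∀ {a b c d} → b ∈ A → d ∈ A → b ≢ d → SameSum a b c d → ¬ OppositeSum a b a c
    opposite-core {a} {b} {c} {d} b∈ d∈ b≢d same opp =
      free-list ((b≢d ∷ []) ∷ [] ∷ []) (b∈ ∷ d∈ ∷ []) (s≤s z≤n) (≤ᵇ⇒≤ 2 6 _)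
        λ j → p∣-comb (+ 1) (ℤ.- (s a j ℤ.+ s c j)) (∣m∣n⇒∣m-n (∣m∣n⇒∣m+n (opp j) (opp j)) (same j)) p∣p (lemma (s a j) (s b j) (s c j) (s d j))
      where
      lemma : ∀ a b c d → b ℤ.+ (d ℤ.+ 0ℤ) ≡
        + 1 ℤ.* (((a ℤ.+ b) ℤ.+ (a ℤ.+ c)) ℤ.+ ((a ℤ.+ b) ℤ.+ (a ℤ.+ c)) ℤ.- ((a ℤ.+ b) ℤ.- (c ℤ.+ d))) ℤ.+ ℤ.- (a ℤ.+ c) ℤ.* + 3
      lemma = solve-∀

    record Pair : Set where
      constructor mkPair
      field
        {fst snd} : Fin n
        fst∈ : fst ∈ A
        snd∈ : snd ∈ A
        fst≢snd : fst ≢ snd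
    open Pair

    Same Opposite Disjoint : Pair → Pair → Set
    Same     P Q = SameSum (fst P) (snd P) (fst Q) (snd Q)
    Opposite P Q = OppositeSum (fst P) (snd P) (fst Q) (snd Q)
    Disjoint P Q = (fst P ≢ fst Q × fst P ≢ snd Q) × (snd P ≢ fst Q × snd P ≢ snd Q)

    -- If pairs with equal sums share a term, their other terms have equal values and hence
    -- coincide, as the terms of `A` are distinct. So overlapping pairs are equal up to order.
    same-disjoint : ∀ P Q → ¬ (fst P ≡ fst Q × snd P ≡ snd Q) → ¬ (fst P ≡ snd Q × snd P ≡ fst Q) → Same P Q → Disjoint P Q
    same-disjoint (mkPair {a} {b} a∈ b∈ _) (mkPair {c} {d} c∈ d∈ _) ¬eq ¬flip same =
      ( (λ { refl → ¬eq (refl , share b∈ d∈ same) })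
      , (λ { refl → ¬flip (refl , share b∈ c∈ (swapʳ {a} {b} {c} {a} same)) })) ,
      ( (λ { refl → ¬flip (share a∈ d∈ (swapˡ {a} {c} {c} {d} same) , refl) })
      , (λ { refl → ¬eq (share a∈ c∈ (swapˡ {a} {b} {b} {c} (swapʳ {a} {b} {c} {b} same)) , refl) }))

    -- Three disjoint pairs with the common sum x have total 3x = 0, and their six terms just meet
    -- the bound 2p.
    three-same : ∀ P Q R → Disjoint P Q → Disjoint P R → Disjoint Q R → Same P Q → ¬ Same P R
    three-same (mkPair {a} {b} a∈ b∈ ab) (mkPair {c} {d} c∈ d∈ cd) (mkPair {e} {f} e∈ f∈ ef)
      ((ac , ad) , bc , bd) ((ae , af) , be , bf) ((ce , cf) , de , df) h k =
      free-list ((ab ∷ ac ∷ ad ∷ ae ∷ af ∷ []) ∷ (bc ∷ bd ∷ be ∷ bf ∷ []) ∷ (cd ∷ ce ∷ cf ∷ []) ∷ (de ∷ df ∷ []) ∷ (ef ∷ []) ∷ [] ∷ [])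
        (a∈ ∷ b∈ ∷ c∈ ∷ d∈ ∷ e∈ ∷ f∈ ∷ []) (s≤s z≤n) ≤-refl
        λ j → p∣-comb (ℤ.- + 1) (s a j ℤ.+ s b j) (∣m∣n⇒∣m+n (h j) (k j)) p∣p (lemma (s a j) (s b j) (s c j) (s d j) (s e j) (s f j))
      where
      lemma : ∀ a b c d e f → a ℤ.+ (b ℤ.+ (c ℤ.+ (d ℤ.+ (e ℤ.+ (f ℤ.+ 0ℤ))))) ≡
        ℤ.- + 1 ℤ.* (((a ℤ.+ b) ℤ.- (c ℤ.+ d)) ℤ.+ ((a ℤ.+ b) ℤ.- (e ℤ.+ f))) ℤ.+ (a ℤ.+ b) ℤ.* + 3
      lemma = solve-∀

    -- When the opposite pair {a, o} meets {a, b}, the pair `Q` with the same sum takes the place of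
    -- {a, b}. It forms four terms of sum zero with {a, o} unless it contains o, and that case is
    -- `opposite-core`.
    two-same-meeting : ∀ Q {a b o} → a ∈ A → b ∈ A → o ∈ A → a ≢ o → a ≢ fst Q → a ≢ snd Q → b ≢ fst Q → b ≢ snd Q →
      SameSum a b (fst Q) (snd Q) → ¬ OppositeSum a b a o
    two-same-meeting (mkPair {c} {d} c∈ d∈ cd) {a} {b} {o} a∈ b∈ o∈ ao ac ad bc bd same opp with o Fin.≟ c | o Fin.≟ d
    ... | yes refl | _        = opposite-core {a} {b} {c} {d} b∈ d∈ bd same opp
    ... | no _     | yes refl = opposite-core {a} {b} {d} {c} b∈ c∈ bc (swapʳ {a} {b} {c} {d} same) opp
    ... | no oc    | no od    = no-opposite-disjoint c∈ d∈ a∈ o∈ cd (ac ∘ sym) (oc ∘ sym) (ad ∘ sym) (od ∘ sym) ao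
      λ j → subst p∣_ (lemma (s a j) (s b j) (s c j) (s d j) (s o j)) (∣m∣n⇒∣m-n (opp j) (same j))
      where
      lemma : ∀ a b c d o → ((a ℤ.+ b) ℤ.+ (a ℤ.+ o)) ℤ.- ((a ℤ.+ b) ℤ.- (c ℤ.+ d)) ≡ (c ℤ.+ d) ℤ.+ (a ℤ.+ o)
      lemma = solve-∀

    two-same : ∀ P Q R → Disjoint P Q → Same P Q → ¬ Opposite P R
    two-same (mkPair {a} {b} a∈ b∈ ab) Q (mkPair {e} {f} e∈ f∈ ef) ((ac , ad) , bc , bd) same opp
      with a Fin.≟ e | a Fin.≟ f | b Fin.≟ e | b Fin.≟ f
    ... | yes refl | _ | _ | _ = two-same-meeting Q a∈ b∈ f∈ ef ac ad bc bd same opp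
    ... | no _ | yes refl | _ | _ = two-same-meeting Q a∈ b∈ e∈ (ef ∘ sym) ac ad bc bd same
            λ j → subst p∣_ (cong (ℤ._+_ (s a j ℤ.+ s b j)) (ℤ.+-comm (s e j) (s a j))) (opp j)
    ... | no _ | no _ | yes refl | _ = two-same-meeting Q b∈ a∈ f∈ ef bc bd ac ad (swapˡ {a} {b} same)
            λ j → subst p∣_ (cong (ℤ._+ (s b j ℤ.+ s f j)) (ℤ.+-comm (s a j) (s b j))) (opp j)
    ... | no _ | no _ | no _ | yes refl = two-same-meeting Q b∈ a∈ e∈ (ef ∘ sym) bc bd ac ad (swapˡ {a} {b} same)
            λ j → subst p∣_ (cong₂ ℤ._+_ (ℤ.+-comm (s a j) (s b j)) (ℤ.+-comm (s e j) (s b j))) (opp j)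
    ... | no ae | no af | no be | no bf = no-opposite-disjoint a∈ b∈ e∈ f∈ ab ae af be bf ef opp

    module _ {m} (f : Fin (suc m) → Fin n) (f∈ : ∀ i → f i ∈ A) (f-inj : ∀ {i j} → f i ≡ f j → i ≡ j) where

      first second : Fin (suc m * m) → Fin (suc m)
      first  t = proj₁ (remQuot {suc m} m t)
      second t = punchIn (first t) (proj₂ (remQuot {suc m} m t))

      first≢second : ∀ t → first t ≢ second t
      first≢second t eq = Fin.punchInᵢ≢i (first t) (proj₂ (remQuot {suc m} m t)) (sym eq)

      pair : Fin (suc m * m) → Pair
      pair t = mkPair (f∈ (first t)) (f∈ (second t)) (first≢second t ∘ f-inj)

      -- Each unordered pair occurs in both orders, which are given opposite signs.
      positive : Fin (suc m * m) → Bool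
      positive t = does (first t Fin.<? second t)

      pairSum signedSum : Fin (suc m * m) → V 4
      pairSum t j = s (fst (pair t)) j ℤ.+ s (snd (pair t)) j
      signedSum t j = if positive t then pairSum t j else ℤ.- pairSum t j

      ordered-pair-injective : ∀ t t′ → first t ≡ first t′ → second t ≡ second t′ → t ≡ t′
      ordered-pair-injective t t′ eq eq′ =
        trans (sym (Fin.combine-remQuot {suc m} m t)) (trans (cong₂ Fin.combine eq (Fin.punchIn-injective (first t) _ _ (trans eq′ (cong (λ i → punchIn i _) (sym eq))))) (Fin.combine-remQuot {suc m} m t′))

      same-sign-disjoint : ∀ t t′ → t ≢ t′ → positive t ≡ positive t′ → Same (pair t) (pair t′) → Disjoint (pair t) (pair t′)
      same-sign-disjoint t t′ t≢t′ sign = same-disjoint (pair t) (pair t′)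
        (λ (eq , eq′) → t≢t′ (ordered-pair-injective t t′ (f-inj eq) (f-inj eq′)))
        (λ (eq , eq′) → <?-asym (first≢second t)
          (trans sign (cong₂ (λ a b → does (a Fin.<? b)) (sym (f-inj eq′)) (sym (f-inj eq)))))

      Related : Bool → Bool → Pair → Pair → Set
      Related true  true  = Same
      Related false false = Same
      Related true  false = Opposite
      Related false true  = Opposite

      related : ∀ t t′ → Equal signedSum t t′ → Related (positive t) (positive t′) (pair t) (pair t′)
      related t t′ h with positive t | positive t′
      ... | true  | true  = h
      ... | true  | false = λ j → subst p∣_ (lemma (pairSum t j) (pairSum t′ j)) (h j)
        where
        lemma : ∀ a b → a ℤ.- (ℤ.- b) ≡ a ℤ.+ b
        lemma = solve-∀
      ... | false | true  = λ j → p∣-scale (ℤ.- + 1) (h j) (lemma (pairSum t j) (pairSum t′ j))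
        where
        lemma : ∀ a b → a ℤ.+ b ≡ ℤ.- + 1 ℤ.* (ℤ.- a ℤ.- b)
        lemma = solve-∀
      ... | false | false = λ j → p∣-scale (ℤ.- + 1) (h j) (lemma (pairSum t j) (pairSum t′ j))
        where
        lemma : ∀ a b → a ℤ.- b ≡ ℤ.- + 1 ℤ.* (ℤ.- a ℤ.- (ℤ.- b))
        lemma = solve-∀

      -- Two of the three signs agree. If the third agrees as well, the pairs give six terms;
      -- otherwise it belongs to a pair with the opposite sum.
      no-three-equal : ∀ t u v → t ≢ u → t ≢ v → u ≢ v →
        Equal signedSum t u → Equal signedSum t v → Equal signedSum u v → ¬ Equal signedSum u t
      no-three-equal t u v t≢u t≢v u≢v tu tv uv ut = cases (positive t) (positive u) (positive v) refl refl refl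
        where
        rel : ∀ {x y} t u → positive t ≡ x → positive u ≡ y → Equal signedSum t u → Related x y (pair t) (pair u)
        rel t u refl refl = related t u
        all-same : positive t ≡ positive u → positive t ≡ positive v →
          Same (pair t) (pair u) → Same (pair t) (pair v) → Same (pair u) (pair v) → Empty
        all-same x y a b c = three-same (pair t) (pair u) (pair v)
          (same-sign-disjoint t u t≢u x a) (same-sign-disjoint t v t≢v y b) (same-sign-disjoint u v u≢v (trans (sym x) y) c) a b
        odd-one : ∀ t u v → t ≢ u → positive t ≡ positive u → Same (pair t) (pair u) → ¬ Opposite (pair t) (pair v)
        odd-one t u v t≢u x a = two-same (pair t) (pair u) (pair v) (same-sign-disjoint t u t≢u x a) a
        cases : ∀ x y z → positive t ≡ x → positive u ≡ y → positive v ≡ z → Empty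
        cases true  true  true  a b c = all-same (trans a (sym b)) (trans a (sym c)) (rel t u a b tu) (rel t v a c tv) (rel u v b c uv)
        cases false false false a b c = all-same (trans a (sym b)) (trans a (sym c)) (rel t u a b tu) (rel t v a c tv) (rel u v b c uv)
        cases true  true  false a b c = odd-one t u v t≢u (trans a (sym b)) (rel t u a b tu) (rel t v a c tv)
        cases false false true  a b c = odd-one t u v t≢u (trans a (sym b)) (rel t u a b tu) (rel t v a c tv)
        cases true  false true  a b c = odd-one t v u t≢v (trans a (sym c)) (rel t v a c tv) (rel t u a b tu)
        cases false true  false a b c = odd-one t v u t≢v (trans a (sym c)) (rel t v a c tv) (rel t u a b tu)
        cases false true  true  a b c = odd-one u v t u≢v (trans b (sym c)) (rel u v b c uv) (rel u t b a ut)
        cases true  false false a b c = odd-one u v t u≢v (trans b (sym c)) (rel u v b c uv) (rel u t b a ut)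

      too-many-pairs : p ^ 4 * 2 < suc m * m → Empty
      too-many-pairs big = pick (collide 4 2 ⊤ signedSum (subst (p ^ 4 * 2 <_) (sym (∣⊤∣≡n (suc m * m))) big))
        where
        three : ∀ B → Collision signedSum B → (∃ λ (g : Fin 3 → Fin (suc m * m)) → (∀ i → g i ∈ B) × (∀ {i j} → g i ≡ g j → i ≡ j)) → Empty
        three B coll (g , g∈ , g-inj) = no-three-equal (g 0F) (g 1F) (g 2F) (≢ λ ()) (≢ λ ()) (≢ λ ())
          (coll (g∈ 0F) (g∈ 1F)) (coll (g∈ 0F) (g∈ 2F)) (coll (g∈ 1F) (g∈ 2F)) (coll (g∈ 1F) (g∈ 0F))
          where
          ≢ : ∀ {x y : Fin 3} → x ≢ y → g x ≢ g y
          ≢ x≢y eq = x≢y (g-inj eq)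
        pick : ¬ ∃ λ B → B ⊆ ⊤ × 2 < ∣ B ∣ × Collision signedSum B
        pick (B , _ , 2<B , coll) = three B coll (enumerate 3 B 2<B)

    contra : 14 ≤ ∣ A ∣ → Empty
    contra big = go (enumerate 14 A big)
      where
      go : ¬ ∃ λ (f : Fin 14 → Fin n) → (∀ i → f i ∈ A) × (∀ {i j} → f i ≡ f j → i ≡ j)
      go (f , f∈ , f-inj) = too-many-pairs {13} f f∈ f-inj (<ᵇ⇒< 162 182 _)

  -- Realises a coefficient 0, 1 or 2 of a doubled value by distinct indices.
  copies : ∀ {n} → Fin 3 → Fin n → Fin n → List (Fin n)
  copies 0F i i′ = []
  copies 1F i i′ = i ∷ []
  copies 2F i i′ = i ∷ i′ ∷ []

  length-copies : ∀ {n} c (i i′ : Fin n) → length (copies c i i′) ≡ toℕ c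
  length-copies 0F i i′ = refl
  length-copies 1F i i′ = refl
  length-copies 2F i i′ = refl

  copies-All : ∀ {n} {P : Fin n → Set} c {i i′} → P i → P i′ → All P (copies c i i′)
  copies-All 0F h k = []
  copies-All 1F h k = h ∷ []
  copies-All 2F h k = h ∷ k ∷ []

  copies-unique : ∀ {n} c {i i′ : Fin n} → i ≢ i′ → Unique (copies c i i′)
  copies-unique 0F h = []
  copies-unique 1F h = [] ∷ []
  copies-unique 2F h = (h ∷ []) ∷ [] ∷ []

  copies-sum : ∀ {n d} c {i i′ : Fin n} (s : Fin n → V d) → Equal s i i′ → ∀ j →
    p∣ ∑ₗ (copies c i i′) (λ t → s t j) ℤ.- + toℕ c ℤ.* s i j
  copies-sum 0F {i} s h j = p∣-scale 0ℤ p∣0 (lemma (s i j))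
    where
    lemma : ∀ a → 0ℤ ℤ.- 0ℤ ℤ.* a ≡ 0ℤ ℤ.* 0ℤ
    lemma = solve-∀
  copies-sum 1F {i} s h j = p∣-scale 0ℤ p∣0 (lemma (s i j))
    where
    lemma : ∀ a → (a ℤ.+ 0ℤ) ℤ.- + 1 ℤ.* a ≡ 0ℤ ℤ.* 0ℤ
    lemma = solve-∀
  copies-sum 2F {i} {i′} s h j = p∣-scale (ℤ.- + 1) (h j) (lemma (s i j) (s i′ j))
    where
    lemma : ∀ a b → (a ℤ.+ (b ℤ.+ 0ℤ)) ℤ.- + 2 ℤ.* a ≡ ℤ.- + 1 ℤ.* (a ℤ.- b)
    lemma = solve-∀

  no-triple : ∀ {n} {s : Fin n → V 4} {A} → Free Small₂ s A → ∀ {a b c} → a ∈ A → b ∈ A → c ∈ A →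
    a ≢ b → a ≢ c → b ≢ c → Equal s a b → ¬ Equal s a c
  no-triple {s = s} free {a} {b} {c} a∈ b∈ c∈ ab ac bc h k =
    Free-list {Small = Small₂} free ((ab ∷ ac ∷ []) ∷ (bc ∷ []) ∷ [] ∷ []) (a∈ ∷ b∈ ∷ c∈ ∷ []) (s≤s z≤n)
      (λ j → p∣-comb (ℤ.- + 1) (s a j) (∣m∣n⇒∣m+n (h j) (k j)) p∣p (lemma (s a j) (s b j) (s c j))) (≤ᵇ⇒≤ 3 6 _)
    where
    lemma : ∀ a b c → a ℤ.+ (b ℤ.+ (c ℤ.+ 0ℤ)) ≡ ℤ.- + 1 ℤ.* ((a ℤ.- b) ℤ.+ (a ℤ.- c)) ℤ.+ a ℤ.* + 3
    lemma = solve-∀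

  module Doubles {n} (s : Fin n → V 4) (A : Subset n) (free : Free Small₂ s A) (big : 15 ≤ ∣ A ∣)
                 {i i′ j j′ : Fin n} (i∈ : i ∈ A) (i′∈ : i′ ∈ A) (j∈ : j ∈ A) (j′∈ : j′ ∈ A)
                 (i≢i′ : i ≢ i′) (i≢j : i ≢ j) (i≢j′ : i ≢ j′) (i′≢j : i′ ≢ j) (i′≢j′ : i′ ≢ j′) (j≢j′ : j ≢ j′)
                 (i≈i′ : Equal s i i′) (j≈j′ : Equal s j j′) where

    doubled : List (Fin n)
    doubled = i ∷ i′ ∷ j ∷ j′ ∷ []

    doubled-unique : Unique doubled
    doubled-unique = (i≢i′ ∷ i≢j ∷ i≢j′ ∷ []) ∷ (i′≢j ∷ i′≢j′ ∷ []) ∷ (j≢j′ ∷ []) ∷ [] ∷ []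

    A′ : Subset n
    A′ = A ─ fromList doubled

    ∣A′∣ : 11 ≤ ∣ A′ ∣
    ∣A′∣ = +-cancelˡ-≤ 4 11 ∣ A′ ∣ (≤-trans big (≤-reflexive
      (trans (∣∣-─ A (fromList doubled) (fromList⁻ (i∈ ∷ i′∈ ∷ j∈ ∷ j′∈ ∷ []))) (cong (_+ ∣ A′ ∣) (∣fromList∣ doubled-unique)))))

    A′⊆A : A′ ⊆ A
    A′⊆A = p─q⊆p A (fromList doubled)

    -- At most four further terms, taken from the doubled values, complete l to a zero-sum sequence.
    no-completion : ∀ {l} → Unique l → All (_∈ A′) l → 0 < length l → ∀ c c′ →
      (∀ r → p∣ (∑ₗ l (λ t → s t r) ℤ.+ + toℕ c ℤ.* s j r) ℤ.+ + toℕ c′ ℤ.* s i r) → 6 < length l + (toℕ c + toℕ c′)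
    no-completion {l} unique ∈A′ 0<l c c′ z = ≰⇒> λ short →
      Free-list {Small = Small₂} free
        (AllPairs.++⁺ unique extra-unique (All.map (fresh ∘ ∉fromList⇒≢ doubled ∘ ∉-─ A (fromList doubled)) ∈A′))
        (All.++⁺ (All.map A′⊆A ∈A′) (All.++⁺ (copies-All c j∈ j′∈) (copies-All c′ i∈ i′∈)))
        (≤-trans 0<l (≤-trans (m≤m+n (length l) _) (≤-reflexive (sym (length-++ l)))))
        sum-zero
        (≤-trans (≤-reflexive (trans (length-++ l) (cong (_+_ (length l)) (trans (length-++ (copies c j j′)) (cong₂ _+_ (length-copies c j j′) (length-copies c′ i i′)))))) short)
      where
      extra : List (Fin n)
      extra = copies c j j′ ++ copies c′ i i′
      extra-unique : Unique extra
      extra-unique = AllPairs.++⁺ (copies-unique c j≢j′) (copies-unique c′ i≢i′)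
        (copies-All c (copies-All c′ (i≢j ∘ sym) (i′≢j ∘ sym)) (copies-All c′ (i≢j′ ∘ sym) (i′≢j′ ∘ sym)))
      fresh : ∀ {t} → All (t ≢_) doubled → All (t ≢_) extra
      fresh (ti ∷ ti′ ∷ tj ∷ tj′ ∷ []) = All.++⁺ (copies-All c tj tj′) (copies-All c′ ti ti′)
      sum-zero : ∀ r → p∣ ∑ₗ (l ++ extra) (λ t → s t r)
      sum-zero r = subst p∣_ (sym (trans (∑ₗ-++ l extra f) (cong (ℤ._+_ (∑ₗ l f)) (∑ₗ-++ (copies c j j′) (copies c′ i i′) f))))
        (subst p∣_ (lemma (∑ₗ l f) (+ toℕ c ℤ.* s j r) (+ toℕ c′ ℤ.* s i r) (∑ₗ (copies c j j′) f) (∑ₗ (copies c′ i i′) f))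
          (∣m∣n⇒∣m+n (z r) (∣m∣n⇒∣m+n (copies-sum c s j≈j′ r) (copies-sum c′ s i≈i′ r))))
        where
        f : Fin n → ℤ
        f t = s t r
        lemma : ∀ x u v a b → ((x ℤ.+ u) ℤ.+ v) ℤ.+ ((a ℤ.- u) ℤ.+ (b ℤ.- v)) ≡ x ℤ.+ (a ℤ.+ b)
        lemma = solve-∀

    opaque
      pivot-i : ∃ λ k → p∤ s i k
      pivot-i = ¬Zero⇒∃ (s i) (Free⇒nonzero {Small = Small₂} free (s≤s z≤n) i∈)

    mod-i : V 4 → V 3
    mod-i = quotient (s i) (proj₁ pivot-i)

    opaque
      -- The doubled values a and b are independent: otherwise b + c a = 0 for some c ≤ 2, and b
      -- with c copies of a is a short zero-sum.
      pivot-j : ∃ λ k → p∤ mod-i (s j) k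
      pivot-j = ¬Zero⇒∃ (mod-i (s j)) λ z → not-multiple (quotient-kernel (s i) (proj₁ pivot-i) (s j) (proj₂ pivot-i) z)
        where
        not-multiple : ¬ ∃ λ (c : Fin 3) → Zero (λ r → s j r ℤ.+ + toℕ c ℤ.* s i r)
        not-multiple (c , z) =
          Free-list {Small = Small₂} free (copies-All c (i≢j ∘ sym) (i′≢j ∘ sym) ∷ copies-unique c i≢i′) (j∈ ∷ copies-All c i∈ i′∈) (s≤s z≤n)
            (λ r → subst p∣_ (lemma (s j r) (+ toℕ c ℤ.* s i r) (∑ₗ (copies c i i′) (λ t → s t r))) (∣m∣n⇒∣m+n (z r) (copies-sum c s i≈i′ r)))
            (≤-trans (s≤s (≤-trans (≤-reflexive (length-copies c i i′)) (<⇒≤ (Fin.toℕ<n c)))) (≤ᵇ⇒≤ 4 6 _))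
          where
          lemma : ∀ x u a → (x ℤ.+ u) ℤ.+ (a ℤ.- u) ≡ x ℤ.+ a
          lemma = solve-∀

    -- The class of a term modulo the plane ⟨a, b⟩, formed by two successive quotients by lines.
    y : Fin n → V 2
    y t = quotient (mod-i (s j)) (proj₁ pivot-j) (mod-i (s t))

    lift : ∀ l → Zero (λ r → ∑ₗ l (λ t → y t r)) →
      ∃ λ (c : Fin 3) → ∃ λ (c′ : Fin 3) → ∀ r → p∣ (∑ₗ l (λ t → s t r) ℤ.+ + toℕ c ℤ.* s j r) ℤ.+ + toℕ c′ ℤ.* s i r
    lift l z = lift-j (quotient-kernel (mod-i (s j)) (proj₁ pivot-j) (mod-i X) (proj₂ pivot-j) mod-X-zero)
      where
      X : V 4
      X r = ∑ₗ l (λ t → s t r)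
      mod-X-zero : Zero (quotient (mod-i (s j)) (proj₁ pivot-j) (mod-i X))
      mod-X-zero r = subst p∣_ (sym (trans
        (quotient-cong (mod-i (s j)) (proj₁ pivot-j) (quotient-∑ₗ (s i) (proj₁ pivot-i) s l) r)
        (quotient-∑ₗ (mod-i (s j)) (proj₁ pivot-j) (λ t → mod-i (s t)) l r))) (z r)
      Result : Set
      Result = ∃ λ (c : Fin 3) → ∃ λ (c′ : Fin 3) → ∀ r → p∣ (X r ℤ.+ + toℕ c ℤ.* s j r) ℤ.+ + toℕ c′ ℤ.* s i r
      lift-j : (∃ λ (c : Fin 3) → Zero (λ r → mod-i X r ℤ.+ + toℕ c ℤ.* mod-i (s j) r)) → Result
      lift-j (c , z) = c , quotient-kernel (s i) (proj₁ pivot-i) (λ r → X r ℤ.+ + toℕ c ℤ.* s j r) (proj₂ pivot-i)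
        (λ r → subst p∣_ (sym (quotient-linear (s i) (proj₁ pivot-i) X (s j) (+ toℕ c) r)) (z r))

    -- Two terms and at most four doubled ones stay within the bound 6.
    no-short : ∀ {l} → Unique l → All (_∈ A′) l → 0 < length l → length l ≤ 2 → ¬ Zero (λ r → ∑ₗ l (λ t → y t r))
    no-short {l} unique ∈A′ 0<l short z = absurd (lift l z)
      where
      absurd : ¬ ∃ λ (c : Fin 3) → ∃ λ (c′ : Fin 3) → ∀ r → p∣ (∑ₗ l (λ t → s t r) ℤ.+ + toℕ c ℤ.* s j r) ℤ.+ + toℕ c′ ℤ.* s i r
      absurd (c , c′ , z′) = <⇒≱ (no-completion unique ∈A′ 0<l c c′ z′)
        (+-mono-≤ short (+-mono-≤ (≤-pred (Fin.toℕ<n c)) (≤-pred (Fin.toℕ<n c′))))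

    -- With three terms a completion is too long only if it uses all four doubled terms. So every
    -- triple of class zero has the same sum -2a - 2b.
    triple-sum : ∀ {t u v} → t ∈ A′ → u ∈ A′ → v ∈ A′ → t ≢ u → t ≢ v → u ≢ v → Zero (λ r → ∑ₗ (t ∷ u ∷ v ∷ []) (λ t → y t r)) →
      ∀ r → p∣ (∑ₗ (t ∷ u ∷ v ∷ []) (λ t → s t r) ℤ.+ + 2 ℤ.* s j r) ℤ.+ + 2 ℤ.* s i r
    triple-sum {t} {u} {v} t∈ u∈ v∈ tu tv uv z = cases (lift (t ∷ u ∷ v ∷ []) z)
      where
      cases : (∃ λ (c : Fin 3) → ∃ λ (c′ : Fin 3) → ∀ r → p∣ (∑ₗ (t ∷ u ∷ v ∷ []) (λ t → s t r) ℤ.+ + toℕ c ℤ.* s j r) ℤ.+ + toℕ c′ ℤ.* s i r) →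
        ∀ r → p∣ (∑ₗ (t ∷ u ∷ v ∷ []) (λ t → s t r) ℤ.+ + 2 ℤ.* s j r) ℤ.+ + 2 ℤ.* s i r
      cases (c , c′ , z′) = both-two c c′ z′ (no-completion ((tu ∷ tv ∷ []) ∷ (uv ∷ []) ∷ [] ∷ []) (t∈ ∷ u∈ ∷ v∈ ∷ []) (s≤s z≤n) c c′ z′)
        where
        both-two : ∀ (c c′ : Fin 3) → (∀ r → p∣ (∑ₗ (t ∷ u ∷ v ∷ []) (λ t → s t r) ℤ.+ + toℕ c ℤ.* s j r) ℤ.+ + toℕ c′ ℤ.* s i r) → 6 < 3 + (toℕ c + toℕ c′) →
          ∀ r → p∣ (∑ₗ (t ∷ u ∷ v ∷ []) (λ t → s t r) ℤ.+ + 2 ℤ.* s j r) ℤ.+ + 2 ℤ.* s i r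
        both-two 2F 2F z′ _ = z′
        both-two 0F c′ _ long = contradiction (+-monoʳ-≤ 3 (≤-trans (Fin.toℕ≤pred[n] c′) (n≤1+n 2))) (<⇒≱ long)
        both-two 1F c′ _ long = contradiction (+-monoʳ-≤ 3 (s≤s (Fin.toℕ≤pred[n] c′))) (<⇒≱ long)
        both-two 2F 0F _ long = contradiction (≤ᵇ⇒≤ 5 6 _) (<⇒≱ long)
        both-two 2F 1F _ long = contradiction (≤ᵇ⇒≤ 6 6 _) (<⇒≱ long)

    -- Both triples have the sum prescribed by `triple-sum`, so the exchanged terms have equal
    -- values.
    forced : ∀ {t t′ u v} → t ∈ A′ → t′ ∈ A′ → u ∈ A′ → v ∈ A′ → t ≢ u → t ≢ v → t′ ≢ u → t′ ≢ v → u ≢ v →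
      Zero (λ r → ∑ₗ (t ∷ u ∷ v ∷ []) (λ t → y t r)) → Zero (λ r → ∑ₗ (t′ ∷ u ∷ v ∷ []) (λ t → y t r)) → Equal s t t′
    forced {t} {t′} {u} {v} t∈ t′∈ u∈ v∈ tu tv t′u t′v uv z z′ r =
      subst p∣_ (lemma (s t r) (s t′ r) (s u r ℤ.+ (s v r ℤ.+ 0ℤ)) (+ 2 ℤ.* s j r) (+ 2 ℤ.* s i r))
        (∣m∣n⇒∣m-n (triple-sum t∈ u∈ v∈ tu tv uv z r) (triple-sum t′∈ u∈ v∈ t′u t′v uv z′ r))
      where
      lemma : ∀ a a′ b c d → (((a ℤ.+ b) ℤ.+ c) ℤ.+ d) ℤ.- (((a′ ℤ.+ b) ℤ.+ c) ℤ.+ d) ≡ a ℤ.- a′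
      lemma = solve-∀

    line? : ∀ k t → Dec (OnLine k (y t 0F) (y t 1F))
    line? k t = OnLine? k (y t 0F) (y t 1F)

    T : Fin 4 → Subset n
    T k = A′ ↾ line? k

    T⊆A′ : ∀ k {t} → t ∈ T k → t ∈ A′
    T⊆A′ k = ↾-⊆ A′ (line? k)

    T-line : ∀ k {t} → t ∈ T k → OnLine k (y t 0F) (y t 1F)
    T-line k t∈ = proj₂ (↾⁻ A′ (line? k) t∈)

    y-nonnull : ∀ {t} → t ∈ A′ → ¬ Null (y t 0F) (y t 1F)
    y-nonnull {t} t∈ (z , z′) = no-short ([] ∷ []) (t∈ ∷ []) (s≤s z≤n) (s≤s z≤n) λ { 0F → ∣m∣n⇒∣m+n z p∣0 ; 1F → ∣m∣n⇒∣m+n z′ p∣0 }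

    -- Nonzero classes on one line of F₃² are equal or opposite, and opposite ones would be two
    -- terms of class sum zero.
    T-const : ∀ k {t u} → t ∈ T k → u ∈ T k → t ≢ u → Equal y t u
    T-const k {t} {u} t∈ u∈ t≢u =
      by-cases (same-line k (T-line k t∈) (T-line k u∈) (y-nonnull (T⊆A′ k t∈)) (y-nonnull (T⊆A′ k u∈)))
      where
      lemma : ∀ a b → a ℤ.+ b ≡ a ℤ.+ (b ℤ.+ 0ℤ)
      lemma = solve-∀
      by-cases : Null (y t 0F ℤ.- y u 0F) (y t 1F ℤ.- y u 1F) ⊎ Null (y t 0F ℤ.+ y u 0F) (y t 1F ℤ.+ y u 1F) → Equal y t u
      by-cases (inj₁ (z , z′)) = λ { 0F → z ; 1F → z′ }
      by-cases (inj₂ (z , z′)) = ⊥-elim (no-short ((t≢u ∷ []) ∷ [] ∷ []) (T⊆A′ k t∈ ∷ T⊆A′ k u∈ ∷ []) (s≤s z≤n) ≤-refl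
        λ { 0F → subst p∣_ (lemma (y t 0F) (y u 0F)) z ; 1F → subst p∣_ (lemma (y t 1F) (y u 1F)) z′ })

    T-triple : ∀ k {t u v} → t ∈ T k → u ∈ T k → v ∈ T k → t ≢ u → t ≢ v → Zero (λ r → ∑ₗ (t ∷ u ∷ v ∷ []) (λ t → y t r))
    T-triple k {t} {u} {v} t∈ u∈ v∈ t≢u t≢v r =
      p∣-comb (ℤ.- + 1) (y t r) (∣m∣n⇒∣m+n (T-const k t∈ u∈ t≢u r) (T-const k t∈ v∈ t≢v r)) p∣p (lemma (y t r) (y u r) (y v r))
      where
      lemma : ∀ a b c → a ℤ.+ (b ℤ.+ (c ℤ.+ 0ℤ)) ≡ ℤ.- + 1 ℤ.* ((a ℤ.- b) ℤ.+ (a ℤ.- c)) ℤ.+ a ℤ.* + 3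
      lemma = solve-∀

    -- Any three of four terms with one class have class sum zero. Exchanging one of them for the
    -- fourth shows that three values agree, and these sum to zero.
    ∣T∣≤3 : ∀ k → ∣ T k ∣ ≤ 3
    ∣T∣≤3 k = ≮⇒≥ λ 3<T → absurd (enumerate 4 (T k) 3<T)
      where
      absurd : ¬ ∃ λ (g : Fin 4 → Fin n) → (∀ x → g x ∈ T k) × (∀ {x y} → g x ≡ g y → x ≡ y)
      absurd (g , g∈ , g-inj) = no-triple free (A′⊆A (g∈′ 0F)) (A′⊆A (g∈′ 1F)) (A′⊆A (g∈′ 2F)) (≢ λ ()) (≢ λ ()) (≢ λ ())
          (forced (g∈′ 0F) (g∈′ 1F) (g∈′ 2F) (g∈′ 3F) (≢ λ ()) (≢ λ ()) (≢ λ ()) (≢ λ ()) (≢ λ ())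
            (T-triple k (g∈ 0F) (g∈ 2F) (g∈ 3F) (≢ λ ()) (≢ λ ())) (T-triple k (g∈ 1F) (g∈ 2F) (g∈ 3F) (≢ λ ()) (≢ λ ())))
          (forced (g∈′ 0F) (g∈′ 2F) (g∈′ 1F) (g∈′ 3F) (≢ λ ()) (≢ λ ()) (≢ λ ()) (≢ λ ()) (≢ λ ())
            (T-triple k (g∈ 0F) (g∈ 1F) (g∈ 3F) (≢ λ ()) (≢ λ ())) (T-triple k (g∈ 2F) (g∈ 1F) (g∈ 3F) (≢ λ ()) (≢ λ ())))
        where
        g∈′ : ∀ x → g x ∈ A′
        g∈′ x = T⊆A′ k (g∈ x)
        ≢ : ∀ {x y : Fin 4} → x ≢ y → g x ≢ g y
        ≢ x≢y eq = x≢y (g-inj eq)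

    different-lines : ∀ {k l t u} → k ≢ l → t ∈ T k → u ∈ T l → t ≢ u
    different-lines {k} {l} k≢l t∈ u∈ refl = y-nonnull (T⊆A′ k t∈) (lines-meet k l k≢l (T-line k t∈) (T-line l u∈))

    -- Every term on line `k` completes the same partners `u` and `v`, so all of them have the same
    -- value, and three equal terms sum to zero.
    ∣T∣≤2 : ∀ {k l m t u v} → k ≢ l → k ≢ m → l ≢ m → t ∈ T k → u ∈ T l → v ∈ T m →
      Zero (λ r → ∑ₗ (t ∷ u ∷ v ∷ []) (λ t → y t r)) → ∣ T k ∣ ≤ 2
    ∣T∣≤2 {k} {l} {m} {t} {u} {v} k≢l k≢m l≢m t∈ u∈ v∈ z = ≮⇒≥ λ 2<T → absurd (enumerate 3 (T k) 2<T)
      where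
      completes : ∀ {t′} → t′ ∈ T k → Zero (λ r → ∑ₗ (t′ ∷ u ∷ v ∷ []) (λ t → y t r))
      completes {t′} t′∈ = by-cases (t′ Fin.≟ t)
        where
        by-cases : Dec (t′ ≡ t) → Zero (λ r → ∑ₗ (t′ ∷ u ∷ v ∷ []) (λ t → y t r))
        by-cases (yes t′≡t) = subst (λ t → Zero (λ r → ∑ₗ (t ∷ u ∷ v ∷ []) (λ t → y t r))) (sym t′≡t) z
        by-cases (no t′≢t)  = λ r → p∣-comb (+ 1) (+ 1) (T-const k t′∈ t∈ t′≢t r) (z r) (lemma (y t′ r) (y t r) (y u r ℤ.+ (y v r ℤ.+ 0ℤ)))
          where
          lemma : ∀ a b c → a ℤ.+ c ≡ + 1 ℤ.* (a ℤ.- b) ℤ.+ + 1 ℤ.* (b ℤ.+ c)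
          lemma = solve-∀
      equal : ∀ {t₁ t₂} → t₁ ∈ T k → t₂ ∈ T k → Equal s t₁ t₂
      equal t₁∈ t₂∈ = forced (T⊆A′ k t₁∈) (T⊆A′ k t₂∈) (T⊆A′ l u∈) (T⊆A′ m v∈)
        (different-lines k≢l t₁∈ u∈) (different-lines k≢m t₁∈ v∈) (different-lines k≢l t₂∈ u∈) (different-lines k≢m t₂∈ v∈)
        (different-lines l≢m u∈ v∈) (completes t₁∈) (completes t₂∈)
      absurd : ¬ ∃ λ (g : Fin 3 → Fin n) → (∀ x → g x ∈ T k) × (∀ {x y} → g x ≡ g y → x ≡ y)
      absurd (g , g∈ , g-inj) = no-triple free (A′⊆A (T⊆A′ k (g∈ 0F))) (A′⊆A (T⊆A′ k (g∈ 1F))) (A′⊆A (T⊆A′ k (g∈ 2F)))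
        (≢ λ ()) (≢ λ ()) (≢ λ ()) (equal (g∈ 0F) (g∈ 1F)) (equal (g∈ 0F) (g∈ 2F))
        where
        ≢ : ∀ {x y : Fin 3} → x ≢ y → g x ≢ g y
        ≢ x≢y eq = x≢y (g-inj eq)

    cover : 11 ≤ Σℕ 4 (λ k → ∣ T k ∣)
    cover = ≤-trans ∣A′∣ (∣∣≤Σ-fibres 4 A′ line? (λ {t} _ → some-line (y t 0F) (y t 1F)))

    T-inhabited : ∀ k → ∃ (_∈ T k)
    T-inhabited k = 0<∣∣⇒∃∈ (T k) (≰⇒> λ empty → <⇒≱ (≤ᵇ⇒≤ 10 11 _) (≤-trans cover (Σ₄≤9 (λ k → ∣ T k ∣) ∣T∣≤3 k empty)))

    contra : Empty
    contra = absurd (four-lines (λ k → y (t k) 0F) (λ k → y (t k) 1F) (λ k → T-line k (t∈ k)) (λ k → y-nonnull (T⊆A′ k (t∈ k))))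
      where
      t : Fin 4 → Fin n
      t k = proj₁ (T-inhabited k)
      t∈ : ∀ k → t k ∈ T k
      t∈ k = proj₂ (T-inhabited k)
      absurd : ¬ ∃ λ k → ∃ λ l → ∃ λ m → k ≢ l × k ≢ m × l ≢ m × NullTriple (λ k → y (t k) 0F) (λ k → y (t k) 1F) k l m
      -- Two lines with at most two terms and two with at most three hold at most 10 of the 11
      -- terms.
      absurd (k , l , m , k≢l , k≢m , l≢m , z , z′) = <⇒≱ (≤ᵇ⇒≤ 11 11 _) (≤-trans cover (Σ₄≤10 (λ k → ∣ T k ∣) ∣T∣≤3 k l k≢l
          (∣T∣≤2 k≢l k≢m l≢m (t∈ k) (t∈ l) (t∈ m) λ { 0F → z ; 1F → z′ })
          (∣T∣≤2 (k≢l ∘ sym) l≢m k≢m (t∈ l) (t∈ k) (t∈ m)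
            λ { 0F → subst p∣_ (swap (y (t k) 0F) (y (t l) 0F) (y (t m) 0F)) z ; 1F → subst p∣_ (swap (y (t k) 1F) (y (t l) 1F) (y (t m) 1F)) z′ })))
        where
        swap : ∀ a b c → a ℤ.+ (b ℤ.+ (c ℤ.+ 0ℤ)) ≡ b ℤ.+ (a ℤ.+ (c ℤ.+ 0ℤ))
        swap = solve-∀

  Duplicate : ∀ {n d} → (Fin n → V d) → Subset n → Set
  Duplicate s A = ∃ λ i → ∃ λ i′ → i ∈ A × i′ ∈ A × i ≢ i′ × Equal s i i′

  duplicate? : ∀ {n d} (s : Fin n → V d) A → Dec (Duplicate s A)
  duplicate? s A = Fin.any? λ i → Fin.any? λ i′ →
    (i ∈? A) ×-dec (i′ ∈? A) ×-dec ¬? (i Fin.≟ i′) ×-dec Zero? (λ j → s i j ℤ.- s i′ j)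

  base₂-3 : Unavoidable Small₂ 4 15
  base₂-3 s A big free with duplicate? s A
  ... | no ¬dup = Distinct.contra s A free (λ i∈ i′∈ i≢i′ eq → ¬dup (_ , _ , i∈ , i′∈ , i≢i′ , eq)) (≤-trans (n≤1+n 14) big)
  ... | yes (i , i′ , i∈ , i′∈ , i≢i′ , i≈i′) = remaining (duplicate? s B)
    where
    B : Subset _
    B = A ─ ⁅ i′ ⁆
    B⊆A : B ⊆ A
    B⊆A = p─q⊆p A ⁅ i′ ⁆
    ≢i′ : ∀ {j} → j ∈ B → i′ ≢ j
    ≢i′ j∈ refl = ∉-─ A ⁅ i′ ⁆ j∈ (x∈⁅x⁆ i′)
    B-big : 14 ≤ ∣ B ∣
    B-big = +-cancelˡ-≤ 1 14 ∣ B ∣ (≤-trans big (≤-reflexive (trans (∣∣-─ A ⁅ i′ ⁆ (λ h → subst (_∈ A) (sym (x∈⁅y⁆⇒x≡y i′ h)) i′∈)) (cong (_+ ∣ B ∣) (∣⁅x⁆∣≡1 i′)))))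
    flip-equal : ∀ {j j′} → Equal s j j′ → Equal s j′ j
    flip-equal {j} {j′} h r = p∣-scale (ℤ.- + 1) (h r) (lemma (s j r) (s j′ r))
      where
      lemma : ∀ a b → b ℤ.- a ≡ ℤ.- + 1 ℤ.* (a ℤ.- b)
      lemma = solve-∀
    remaining : Dec (Duplicate s B) → Empty
    remaining (no ¬dup) = Distinct.contra s B (λ S S⊆B → free S (B⊆A ∘ S⊆B)) (λ j∈ j′∈ j≢j′ eq → ¬dup (_ , _ , j∈ , j′∈ , j≢j′ , eq)) B-big
    -- If `i` belongs to the second coincident pair as well, its value occurs three times.
    remaining (yes (j , j′ , j∈ , j′∈ , j≢j′ , j≈j′)) with i Fin.≟ j | i Fin.≟ j′
    ... | yes refl | _        = no-triple free i∈ i′∈ (B⊆A j′∈) i≢i′ j≢j′ (≢i′ j′∈) i≈i′ j≈j′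
    ... | no _     | yes refl = no-triple free i∈ i′∈ (B⊆A j∈) i≢i′ (j≢j′ ∘ sym) (≢i′ j∈) i≈i′ (flip-equal j≈j′)
    ... | no i≢j   | no i≢j′  = Doubles.contra s A free big i∈ i′∈ (B⊆A j∈) (B⊆A j′∈) i≢i′ i≢j i≢j′ (≢i′ j∈) (≢i′ j′∈) j≢j′ i≈i′ j≈j′

-- All primes together

parity : ∀ n → (∃ λ k → n ≡ k + k) ⊎ (∃ λ k → n ≡ suc (k + k))
parity zero    = inj₁ (0 , refl)
parity (suc n) with parity n
... | inj₁ (k , refl) = inj₂ (k , refl)
... | inj₂ (k , refl) = inj₁ (suc k , cong suc (sym (+-suc k k)))

unavoidable₁ : ∀ q (pr : Prime (suc q)) → let open ModPrime q pr in ∀ e → Unavoidable Small₁ (e + 3) (suc (M * p ^ e))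
unavoidable₁ q pr = cases q pr (parity q)
  where
  cases : ∀ q (pr : Prime (suc q)) → (∃ λ k → q ≡ k + k) ⊎ (∃ λ k → q ≡ suc (k + k)) →
    let open ModPrime q pr in ∀ e → Unavoidable Small₁ (e + 3) (suc (M * p ^ e))
  cases _ pr (inj₁ (0 , refl)) = contradiction pr ¬prime[1]
  cases _ pr (inj₁ (1 , refl)) = iterate Small₁ {3} (λ e → next₁ (2 + e) {M * p ^ e}) (base₁ {0} refl)
    where
    open ModPrime 2 pr
    open ModThree pr
  cases q pr (inj₁ (suc (suc h) , refl)) = main₁ (s≤s (s≤s (subst (2 ≤_) (sym (trans (+-suc h (suc h)) (cong suc (+-suc h h)))) (s≤s (s≤s z≤n))))) (base₁ {suc h} refl)
    where open ModPrime q pr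
  cases _ pr (inj₂ (0 , refl)) = ModTwo.main₁-2 pr
  -- Here p = q + 1 is even and larger than 2, hence not prime.
  cases _ pr (inj₂ (suc k , refl)) with prime⇒irreducible pr {2} (ℕ.divides (suc (suc k)) (lemma k))
    where
    lemma : ∀ k → suc (suc (suc k + suc k)) ≡ suc (suc k) * 2
    lemma = ℕ-solve-∀
  ... | inj₁ ()
  ... | inj₂ ()

unavoidable₂ : ∀ q (pr : Prime (suc q)) → let open ModPrime q pr in ∀ e → Unavoidable Small₂ (e + 4) (suc (M * p ^ e))
unavoidable₂ 2 pr = main₂ base₂-3
  where
  open ModPrime 2 pr
  open ModThree pr
unavoidable₂ q pr with suc q ℕ.∣? 3
... | no p∤3  = main₂ (base₂ p∤3)
  where open ModPrime q pr
... | yes p∣3 with prime⇒irreducible (from-yes (prime? 3)) p∣3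
...   | inj₁ refl = contradiction pr ¬prime[1]
...   | inj₂ refl = main₂ base₂-3
  where
  open ModPrime 2 pr
  open ModThree pr

module _ (q : ℕ) (pr : Prime (suc q)) where
  open ModPrime q pr

  ∑-selSum : ∀ {d n} (s : Seq p d n) S j → ∑ S (λ i → + toℕ (s i j)) ≡ + selSum s S j
  ∑-selSum s []            j = refl
  ∑-selSum s (inside ∷ S)  j = cong (ℤ._+_ (+ toℕ (s zero j))) (∑-selSum (s ∘ suc) S j)
  ∑-selSum s (outside ∷ S) j = ∑-selSum (s ∘ suc) S j

  -- All conditions on a subset are decidable and there are finitely many subsets, so an exhaustive
  -- search turns the refutation of freeness into a witness.
  Unavoidable⇒HasShortZeroSum : ∀ {Small d N n} → (∀ ℓ → Dec (Small ℓ)) → Unavoidable Small d N → N ≤ n →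
    (s : Seq p d n) → HasShortZeroSum s Small
  Unavoidable⇒HasShortZeroSum {Small} {d} {N} {n} small? unav N≤n s
    with anySubset? (λ S → nonempty? S ×-dec Fin.all? (λ j → selSum s S j % p ≟ 0) ×-dec small? ∣ S ∣)
  ... | yes found = found
  ... | no ¬found = contradiction
    (λ S _ 0<S z small → ¬found (S , 0<∣∣⇒∃∈ S 0<S , (λ j → ℕ.n∣m⇒m%n≡0 _ p (∣⇒∣ᵤ (subst p∣_ (∑-selSum s S j) (z j)))) , small))
    (unav (λ i j → + toℕ (s i j)) ⊤ (≤-trans N≤n (≤-reflexive (sym (∣⊤∣≡n n)))))

  sequence-length : ∀ x → suc (M * x) ≤ ((6 * p) ∸ 4) * x + 1
  sequence-length x = ≤-reflexive (trans (+-comm 1 (M * x)) (cong (λ m → m * x + 1) (sym (trans (cong (_∸ 4) (lemma q)) (m+n∸n≡m M 4)))))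
    where
    lemma : ∀ q → 6 * suc q ≡ 6 * q + 2 + 4
    lemma = ℕ-solve-∀

theorem1p3 : (p d : ℕ) → (pr : Prime p) → 3 ≤ d →
    (((s : Seq p d (((6 * p) ∸ 4) * p ^ (d ∸ 3) + 1)) →
    HasShortZeroSum {{prime⇒nonZero pr}} s (λ ℓ → 2 * ℓ ≤ (3 * p) ∸ 1))
    × (4 ≤ d → (s : Seq p d (((6 * p) ∸ 4) * p ^ (d ∸ 4) + 1)) →
    HasShortZeroSum {{prime⇒nonZero pr}} s (λ ℓ → ℓ ≤ 2 * p)))
theorem1p3 zero    d pr 3≤d = contradiction pr ¬prime[0]
theorem1p3 (suc q) d pr 3≤d =
  Unavoidable⇒HasShortZeroSum q pr {Small₁} (λ ℓ → 2 * ℓ ≤? 3 * p ∸ 1)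
    (subst (λ m → Unavoidable Small₁ m (suc (M * p ^ (d ∸ 3)))) (m∸n+n≡m 3≤d) (unavoidable₁ q pr (d ∸ 3)))
    (sequence-length q pr (p ^ (d ∸ 3))) ,
  λ 4≤d → Unavoidable⇒HasShortZeroSum q pr {Small₂} (λ ℓ → ℓ ≤? 2 * p)
    (subst (λ m → Unavoidable Small₂ m (suc (M * p ^ (d ∸ 4)))) (m∸n+n≡m 4≤d) (unavoidable₂ q pr (d ∸ 4)))
    (sequence-length q pr (p ^ (d ∸ 4)))
  where open ModPrime q pr
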